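{- Let $n\ge 2$ and consider the arc-reversal walk on the complete graph $K_n$. The walk does not admit peak state transfer (between any pair of distinct vertices, at any time) for $n>2$, and there is no periodicity at any vertex for $n>3$. The graph $K_2$ admits perfect state transfer at time $1$ and is $2$-periodic at every vertex. The graph $K_3$ is $3$-periodic at every vertex.
   Context: Arc-reversal walk: let $G=(V,E)$ be a finite simple graph without isolated vertices and $\mathcal{A}$ its set of arcs (ordered pairs $(u,v)$ with $uv\in E$; $u$ is the tail). Let $N\in\mathbb{R}^{\mathcal{A}\times V}$ with $N(a,v)=1/\sqrt{d(v)}$ if $v$ is the tail of $a$ and $0$ otherwise ($d(v)$ is the degree), and let $R$ be the permutation matrix on $\mathcal{A}$ swapping $(u,v)$ and $(v,u)$. The transition matrix is $U=R(2NN^T-I)$. Put $B_t=N^TU^tN$ for integers $t\ge0$, and $B=B_1=D^{ -1/2}AD^{ -1/2}$, where $A$ is the adjacency matrix and $D$ the diagonal degree matrix. Let $B=\sum_\theta\theta E_\theta$ be the spectral decomposition ($\theta$ over distinct eigenvalues, $E_\theta$ the orthogonal projection onto the $\theta$-eigenspace). For distinct vertices $u,v$ there is peak state transfer from $u$ to $v$ at time $t$ (a positive integer) if $|B_t(u,v)|=\sum_\theta|E_\theta(u,v)|$ and $E_\theta(u,v)\neq0$ for at least one $\theta$. There is perfect state transfer from $u$ to $v\neq u$ at time $t$ if $U^tN\mathbf{e}_u=\gamma N\mathbf{e}_v$ for some $\gamma\in\mathbb{C}$ with $|\gamma|=1$ (equivalently $|B_t(u,v)|=1$). The walk is periodic at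 $u$ if $U^tN\mathbf{e}_u=\gamma N\mathbf{e}_u$ for some integer $t>0$ and some $|\gamma|=1$; the smallest such $t$ is the period, and the walk is then called $t$-periodic at $u$. -}

module Defs where

open import Algebra.Bundles using (CommutativeRing)
import Algebra.Definitions.RawMonoid as Mult
open import Data.Bool.Base using (Bool; if_then_else_; not; T)
open import Data.Bool.Properties using (T-irrelevant; T-≡; T?)
open import Data.Empty using (⊥-elim)
open import Data.Fin.Base using (Fin; zero; suc)
import Data.Fin.Properties as Fin
open import Data.Fin.Subset using (Subset; ∣_∣; _∈_)
open import Data.Fin.Subset.Properties using (x∈p⇒∣p-x∣<∣p∣)
open import Data.List.Base using (List; foldr; allFin; concatMap; mapMaybe)
open import Data.Maybe.Base using (Maybe; just; nothing)
open import Data.Nat.Base as ℕ using (ℕ; zero; suc; s≤s; z≤n)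
import Data.Nat.Properties as ℕ
open import Data.Product.Base using (Σ; ∃-syntax; _×_; _,_; proj₁)
open import Data.Sum.Base using (_⊎_; inj₁; inj₂)
open import Data.Vec.Base using (tabulate)
open import Data.Vec.Properties using (lookup∘tabulate; lookup⇒[]=)
open import Function.Base using (_∘_)
open import Function.Bundles using (Equivalence)
open import Level using (_⊔_) renaming (suc to lsuc)
open import Relation.Binary.Core using (Rel)
open import Relation.Binary.Definitions using (DecidableEquality; Cotransitive)
open import Relation.Binary.Structures using (IsStrictPartialOrder)
open import Relation.Binary.PropositionalEquality
  using (_≢_; refl; sym; trans; cong)
open import Relation.Nullary using (¬_; yes; no; does)

-- The real numbers, given axiomatically as the Cauchy-complete Archimedean
-- ordered field.  The order axioms (cotransitivity and tightness in place of
-- trichotomy) are the constructive ones, so they hold for the Bishop reals as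
-- well as for the classical reals; classically they determine ℝ up to unique
-- isomorphism.
record RealNumbers c ℓ₁ ℓ₂ : Set (lsuc (c ⊔ ℓ₁ ⊔ ℓ₂)) where
  infix 4 _<_ _≤_ _#_
  infixl 6 _∨_
  field
    commutativeRing : CommutativeRing c ℓ₁
  open CommutativeRing commutativeRing public
    hiding (refl; sym; trans; zero)
    renaming (_-_ to infixl 6 _-_)
  field
    _<_                  : Rel Carrier ℓ₂
    isStrictPartialOrder : IsStrictPartialOrder _≈_ _<_

  _≤_ : Rel Carrier ℓ₂
  x ≤ y = ¬ (y < x)

  _#_ : Rel Carrier ℓ₂
  x # y = x < y ⊎ y < x

  field
    <-cotransitive : Cotransitive _<_
    #-tight        : ∀ {x y} → ¬ (x # y) → x ≈ y
    0<1            : 0# < 1#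
    +-monoˡ-<      : ∀ {x y} z → x < y → x + z < y + z
    *-positive     : ∀ {x y} → 0# < x → 0# < y → 0# < x * y
    inverse        : ∀ {x} → x # 0# → ∃[ y ] x * y ≈ 1#

    _∨_            : Carrier → Carrier → Carrier
    x≤x∨y          : ∀ x y → x ≤ x ∨ y
    y≤x∨y          : ∀ x y → y ≤ x ∨ y
    ∨-least        : ∀ {x y z} → x ≤ z → y ≤ z → x ∨ y ≤ z

  fromℕ : ℕ → Carrier
  fromℕ n = Mult._×_ +-rawMonoid n 1#

  abs : Carrier → Carrier
  abs x = x ∨ (- x)

  IsCauchy : (ℕ → Carrier) → Set (c ⊔ ℓ₂)
  IsCauchy s = ∀ ε → 0# < ε →
    ∃[ N ] (∀ m n → N ℕ.≤ m → N ℕ.≤ n → abs (s m - s n) < ε)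

  ConvergesTo : (ℕ → Carrier) → Carrier → Set (c ⊔ ℓ₂)
  ConvergesTo s l = ∀ ε → 0# < ε →
    ∃[ N ] (∀ n → N ℕ.≤ n → abs (s n - l) < ε)

  field
    archimedean : ∀ x → ∃[ n ] x < fromℕ n
    complete    : ∀ s → IsCauchy s → ∃[ l ] ConvergesTo s l

    -- Redundant: square roots of non-negative numbers are obtained from
    -- completeness.  They are a field only so that √ is available as an
    -- operation; its values on negative numbers are unspecified.
    √_         : Carrier → Carrier
    √-cong     : ∀ {x y} → x ≈ y → √ x ≈ √ y
    √-square   : ∀ {x} → 0# ≤ x → √ x * √ x ≈ x
    √-positive : ∀ {x} → 0# < x → 0# < √ x

  open IsStrictPartialOrder isStrictPartialOrder public
    using (<-respʳ-≈; <-respˡ-≈) renaming (irrefl to <-irrefl; trans to <-trans)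

  0<fromℕ-suc : ∀ n → 0# < fromℕ (suc n)
  0<fromℕ-suc zero    = <-respʳ-≈ (≈-sym (+-identityʳ 1#)) 0<1
    where open CommutativeRing commutativeRing using () renaming (sym to ≈-sym)
  0<fromℕ-suc (suc n) = <-trans (0<fromℕ-suc n)
    (<-respˡ-≈ (+-identityˡ _) (+-monoˡ-< (fromℕ (suc n)) 0<1))

  0<fromℕ : ∀ n → .{{ℕ.NonZero n}} → 0# < fromℕ n
  0<fromℕ (suc n) = 0<fromℕ-suc n


record Graph (n : ℕ) : Set where
  field
    adj         : Fin n → Fin n → Bool
    symmetric   : ∀ {u v} → T (adj u v) → T (adj v u)
    irreflexive : ∀ {u} → ¬ T (adj u u)
    noIsolated  : ∀ u → ∃[ v ] T (adj u v)

  neighbours : Fin n → Subset n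
  neighbours u = tabulate (adj u)

  degree : Fin n → ℕ
  degree u = ∣ neighbours u ∣

  degree-nonZero : ∀ u → ℕ.NonZero (degree u)
  degree-nonZero u with v , uv ← noIsolated u =
    ℕ.>-nonZero (ℕ.≤-<-trans z≤n (x∈p⇒∣p-x∣<∣p∣ v∈))
    where
    v∈ : v ∈ neighbours u
    v∈ = lookup⇒[]= v (neighbours u)
           (trans (lookup∘tabulate (adj u) v) (Equivalence.to T-≡ uv))

module Arcs {n} (G : Graph n) where
  open Graph G

  record Arc : Set where
    constructor arc
    field
      tail head : Fin n
      edge      : T (adj tail head)

  open Arc public

  reverse : Arc → Arc
  reverse (arc u v uv) = arc v u (symmetric uv)

  _≟ᴬ_ : DecidableEquality Arc
  arc u v p ≟ᴬ arc u′ v′ p′ with u Fin.≟ u′ | v Fin.≟ v′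
  ... | yes refl | yes refl = yes (cong (arc u v) (T-irrelevant p p′))
  ... | no u≢u′  | _        = no (u≢u′ ∘ cong tail)
  ... | _        | no v≢v′  = no (v≢v′ ∘ cong head)

  arcs : List Arc
  arcs = concatMap (λ u → mapMaybe (arc? u) (allFin n)) (allFin n)
    where
    arc? : ∀ u v → Maybe Arc
    arc? u v with T? (adj u v)
    ... | yes uv = just (arc u v uv)
    ... | no  _  = nothing

complete-graph : ∀ n → 2 ℕ.≤ n → Graph n
complete-graph n 2≤n = record
  { adj         = adj
  ; symmetric   = λ {u} {v} → symmetric u v
  ; irreflexive = λ {u} → irreflexive u
  ; noIsolated  = noIsolated 2≤n
  }
  where
  adj : ∀ {m} → Fin m → Fin m → Bool
  adj u v = not (does (u Fin.≟ v))

  symmetric : ∀ u v → T (adj u v) → T (adj v u)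
  symmetric u v uv with u Fin.≟ v | v Fin.≟ u
  ... | yes _   | _       = ⊥-elim uv
  ... | no u≢v  | yes v≡u = ⊥-elim (u≢v (sym v≡u))
  ... | no _    | no _    = _

  irreflexive : ∀ u → ¬ T (adj u u)
  irreflexive u uu with u Fin.≟ u
  ... | yes _  = uu
  ... | no u≢u = u≢u refl

  noIsolated : ∀ {m} → 2 ℕ.≤ m → (u : Fin m) → ∃[ v ] T (adj u v)
  noIsolated (s≤s (s≤s z≤n)) zero    = suc zero , _
  noIsolated (s≤s (s≤s z≤n)) (suc u) = zero , _


-- Index sets of vectors and matrices; enum lists every element exactly once.
record Finite (I : Set) : Set where
  field
    _≟_  : DecidableEquality I
    enum : List I

open Finite {{...}}

instance
  Fin-finite : ∀ {n} → Finite (Fin n)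
  Fin-finite = record { _≟_ = Fin._≟_ ; enum = allFin _ }

  Arc-finite : ∀ {n} {G : Graph n} → Finite (Arcs.Arc G)
  Arc-finite {G = G} = record { _≟_ = Arcs._≟ᴬ_ G ; enum = Arcs.arcs G }


module LinearAlgebra {c ℓ₁ ℓ₂} (ℝ : RealNumbers c ℓ₁ ℓ₂) where
  open RealNumbers ℝ

  private variable
    I J K : Set

  infix  4 _≈ᵛ_ _≈ᴹ_
  infixl 7 _*ᴹ_ _*ᵛ_
  infixr 7 _·ᵛ_ _·ᴹ_
  infixl 6 _-ᴹ_
  infixr 8 _^ᴹ_
  infix  9 _ᵀ

  Vec : Set → Set c
  Vec I = I → Carrier

  Matrix : Set → Set → Set c
  Matrix I J = I → J → Carrier

  ∑ : {{Finite I}} → (I → Carrier) → Carrier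
  ∑ f = foldr (λ i s → f i + s) 0# enum

  _≈ᵛ_ : Vec I → Vec I → Set ℓ₁
  x ≈ᵛ y = ∀ i → x i ≈ y i

  _≈ᴹ_ : Matrix I J → Matrix I J → Set ℓ₁
  M ≈ᴹ M′ = ∀ i j → M i j ≈ M′ i j

  0ᵛ : Vec I
  0ᵛ _ = 0#

  1ᴹ : {{Finite I}} → Matrix I I
  1ᴹ i j = if does (i ≟ j) then 1# else 0#

  𝐞 : {{Finite I}} → I → Vec I
  𝐞 i = 1ᴹ i

  _ᵀ : Matrix I J → Matrix J I
  (M ᵀ) j i = M i j

  _*ᴹ_ : {{Finite J}} → Matrix I J → Matrix J K → Matrix I K
  (M *ᴹ M′) i k = ∑ λ j → M i j * M′ j k

  _*ᵛ_ : {{Finite J}} → Matrix I J → Vec J → Vec I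
  (M *ᵛ x) i = ∑ λ j → M i j * x j

  _·ᵛ_ : Carrier → Vec I → Vec I
  (r ·ᵛ x) i = r * x i

  _·ᴹ_ : Carrier → Matrix I J → Matrix I J
  (r ·ᴹ M) i j = r * M i j

  _-ᴹ_ : Matrix I J → Matrix I J → Matrix I J
  (M -ᴹ M′) i j = M i j - M′ i j

  _^ᴹ_ : {{Finite I}} → Matrix I I → ℕ → Matrix I I
  M ^ᴹ zero  = 1ᴹ
  M ^ᴹ suc t = M *ᴹ M ^ᴹ t

  IsEigenvector : {{Finite I}} → Matrix I I → Carrier → Vec I → Set ℓ₁
  IsEigenvector M θ x = M *ᵛ x ≈ᵛ θ ·ᵛ x × ¬ (x ≈ᵛ 0ᵛ)

  IsEigenvalue : {{Finite I}} → Matrix I I → Carrier → Set (c ⊔ ℓ₁)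
  IsEigenvalue M θ = ∃[ x ] IsEigenvector M θ x

  record IsEigenprojection {{_ : Finite I}}
      (M : Matrix I I) (θ : Carrier) (E : Matrix I I) : Set (c ⊔ ℓ₁) where
    field
      symmetric  : E ᵀ ≈ᴹ E
      idempotent : E *ᴹ E ≈ᴹ E
      range⊆     : ∀ x → M *ᵛ (E *ᵛ x) ≈ᵛ θ ·ᵛ (E *ᵛ x)
      range⊇     : ∀ x → M *ᵛ x ≈ᵛ θ ·ᵛ x → E *ᵛ x ≈ᵛ x

  record SpectralDecomposition {{_ : Finite I}}
      (M : Matrix I I) : Set (c ⊔ ℓ₁) where
    field
      size          : ℕ
      θ             : Fin size → Carrier
      E             : Fin size → Matrix I I
      distinct      : ∀ {r s} → r ≢ s → ¬ (θ r ≈ θ s)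
      eigenvalue    : ∀ r → IsEigenvalue M (θ r)
      exhaustive    : ∀ {μ} → IsEigenvalue M μ → ∃[ r ] μ ≈ θ r
      projection    : ∀ r → IsEigenprojection M (θ r) (E r)
      decomposition : M ≈ᴹ λ i j → ∑ λ r → θ r * E r i j


module Complex {c ℓ₁ ℓ₂} (ℝ : RealNumbers c ℓ₁ ℓ₂) where
  open RealNumbers ℝ

  infix  4 _≈ᶜ_
  infixl 7 _*ᶜ_

  record ℂ : Set c where
    constructor _+i_
    field
      re im : Carrier

  open ℂ public

  _≈ᶜ_ : ℂ → ℂ → Set ℓ₁
  z ≈ᶜ w = re z ≈ re w × im z ≈ im w

  _*ᶜ_ : ℂ → ℂ → ℂ
  z *ᶜ w = (re z * re w - im z * im w) +i (re z * im w + im z * re w)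

  fromℝ : Carrier → ℂ
  fromℝ x = x +i 0#

  modulus : ℂ → Carrier
  modulus z = √ (re z * re z + im z * im z)


module ArcReversalWalk {c ℓ₁ ℓ₂} (ℝ : RealNumbers c ℓ₁ ℓ₂)
    {n : ℕ} (G : Graph n) where
  open RealNumbers ℝ
  open LinearAlgebra ℝ
  open Complex ℝ
  open Graph G
  open Arcs G

  √degree#0 : ∀ v → √ (fromℕ (degree v)) # 0#
  √degree#0 v = inj₂ (√-positive (0<fromℕ (degree v) {{degree-nonZero v}}))

  1/√degree : Fin n → Carrier
  1/√degree v = proj₁ (inverse (√degree#0 v))

  N : Matrix Arc (Fin n)
  N a v = if does (tail a ≟ v) then 1/√degree v else 0#

  R : Matrix Arc Arc
  R a b = 1ᴹ (reverse a) b

  U : Matrix Arc Arc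
  U = R *ᴹ (fromℕ 2 ·ᴹ (N *ᴹ N ᵀ) -ᴹ 1ᴹ)

  Bₜ : ℕ → Matrix (Fin n) (Fin n)
  Bₜ t = N ᵀ *ᴹ (U ^ᴹ t *ᴹ N)

  B : Matrix (Fin n) (Fin n)
  B = Bₜ 1

  PeakStateTransfer : Fin n → Fin n → ℕ → Set (c ⊔ ℓ₁)
  PeakStateTransfer u v t =
    u ≢ v × 1 ℕ.≤ t ×
    Σ (SpectralDecomposition B) λ S → let open SpectralDecomposition S in
      abs (Bₜ t u v) ≈ ∑ (λ r → abs (E r u v)) ×
      ∃[ r ] ¬ (E r u v ≈ 0#)

  -- U^t N e_u = γ N e_v for some complex γ of modulus 1.
  Transfers : Fin n → Fin n → ℕ → Set (c ⊔ ℓ₁)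
  Transfers u v t = ∃[ γ ] modulus γ ≈ 1# ×
    (∀ a → fromℝ ((U ^ᴹ t *ᵛ (N *ᵛ 𝐞 u)) a) ≈ᶜ γ *ᶜ fromℝ ((N *ᵛ 𝐞 v) a))

  PerfectStateTransfer : Fin n → Fin n → ℕ → Set (c ⊔ ℓ₁)
  PerfectStateTransfer u v t = u ≢ v × Transfers u v t

  Periodic : Fin n → Set (c ⊔ ℓ₁)
  Periodic u = ∃[ t ] 1 ℕ.≤ t × Transfers u u t

  PeriodicWithPeriod : ℕ → Fin n → Set (c ⊔ ℓ₁)
  PeriodicWithPeriod t u =
    1 ℕ.≤ t × Transfers u u t ×
    (∀ s → 1 ℕ.≤ s → Transfers u u s → t ℕ.≤ s)

module Submission where

-- Write n = d + 1.  The state U^t N e_u of the walk on K_n is invariant under the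
-- vertex permutations fixing u, so it is determined by three amplitudes: its
-- values on the arcs out of u, into u, and away from u (Amplitude).  One step of
-- the walk is a linear recursion on these (U-onArcs, walk≈onArcs), and the
-- entries of B_t are read off from them: the diagonal entry is the amplitude out,
-- the others are total / d, and out + total = 1 is conserved.  Eliminating the
-- other two amplitudes gives
--
--   n B_t(u,u) - 1 = d T_t(-1/d),    n B_t(v,u) = 1 - T_t(-1/d)  for v ≠ u,
--
-- with the Chebyshev polynomials T_t (cosine≈chebyshev, total≈chebyshev).
--
-- The matrix B has the eigenvalues 1 and -1/d with projections J/n and I - J/n,
-- so that the sum of all |E(u,v)| is at least 2/n (spectralMass).  Peak state
-- transfer therefore forces 1 - T_t(-1/d) ≥ 2, that is T_t(-1/d) = -1 since
-- |T_t| ≤ 1 on [-1,1].  Periodicity on at least three vertices forces the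
-- amplitudes into and away to vanish, hence T_t(-1/d) = 1.
--
-- For d > 2 neither value occurs at a positive time.  Let a/b = 2/d in lowest
-- terms; then b > 1.  The numbers 2 b^t T_t(-a/2b) are integers satisfying a
-- recursion that is multiplication by -a modulo b, so for t > 0 they are not
-- divisible by b (∤chebyshev), unlike 2 b^t and -2 b^t.  For d = 2 the numbers
-- 2 T_t(-1/2) repeat 2, -1, -1, which excludes the value -2.
--
-- The statements about K_2 and K_3 follow by running the recursion on amplitudes
-- for at most three steps.

open import Defs
open import Algebra.Bundles using (CommutativeRing)
import Algebra.Properties.Ring as RingProperties
import Algebra.Properties.Semiring.Mult.TCOptimised as Mult
import Algebra.Properties.Semiring.Sum as SemiringSum
import Algebra.Solver.Ring as RingSolver
open import Algebra.Solver.Ring.AlmostCommutativeRing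
  using (fromCommutativeRing; _-Raw-AlmostCommutative⟶_)
open import Data.Bool.Base using (Bool; true; false; if_then_else_; T)
open import Data.Bool.Properties using (T?; T-irrelevant)
open import Data.Empty using (⊥-elim)
open import Data.Fin.Base using (Fin; zero; suc; punchIn)
import Data.Fin.Properties as Fin
open import Data.Integer.Base as ℤ using (ℤ; +_; -[1+_]; _⊖_)
open import Data.Integer.Coprimality using (Coprime; coprime-divisor)
open import Data.Integer.Divisibility.Signed
  using (_∣_; ∣⇒∣ᵤ; ∣ᵤ⇒∣; ∣m∣n⇒∣m+n; ∣n⇒∣m*n; ∣m⇒∣m*n; ∣m⇒∣-m; ∣-refl)
import Data.Integer.Properties as ℤ
open import Data.Integer.Tactic.RingSolver using (solve-∀)
open import Data.List.Base
  using (List; []; _∷_; _++_; foldr; allFin; concatMap; mapMaybe; tabulate)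
open import Data.Maybe.Base using (Maybe; just; nothing; maybe′)
open import Data.Nat.Base as ℕ using (ℕ; zero; suc; s≤s; z≤n)
import Data.Nat.Coprimality as ℕ
import Data.Nat.Divisibility as ℕ
import Data.Nat.DivMod as ℕ
import Data.Nat.GCD as ℕ
import Data.Nat.Properties as ℕ
open import Data.Product.Base using (Σ; _×_; _,_; proj₁; proj₂; ∃-syntax)
open import Data.Sum.Base using (_⊎_; inj₁; inj₂)
import Data.Vec.Base as Vec
open import Function.Base using (_∘_; case_of_; id)
open import Relation.Binary.Definitions using (tri<; tri≈; tri>)
open import Relation.Binary.PropositionalEquality as ≡ using (_≡_; _≢_)
open import Relation.Nullary using (¬_; Dec; yes; no; does; contradiction)

open Finite {{...}}

-- Rescaled Chebyshev values as integers
module IntegerSequence where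
  open import Data.Integer.Base using (_+_; _*_; _-_; -_; _^_; ∣_∣; _≤_; _<_)
  open import Relation.Binary.PropositionalEquality
    using (refl; sym; trans; cong; cong₂; subst; subst₂; module ≡-Reasoning)

  -- chebyshev a b t = 2 b^t T_t(-a/2b), where T_t is the Chebyshev polynomial of
  -- the first kind.  The three-term recursion of T_t turns into one over ℤ.
  chebyshev : ℤ → ℤ → ℕ → ℤ
  chebyshev a b zero          = + 2
  chebyshev a b (suc zero)    = - a
  chebyshev a b (suc (suc t)) =
    - a * chebyshev a b (suc t) - b * b * chebyshev a b t

  -- Modulo b the recursion is multiplication by -a, so the values at positive
  -- times are, up to sign, powers of a, which are prime to b.
  ∤chebyshev : ∀ {a b} → Coprime b a → ∣ b ∣ ≢ 1 →
               ∀ t → ¬ (b ∣ chebyshev a b (suc t))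
  ∤chebyshev {a} {b} coprime ∣b∣≢1 zero b∣-a =
    ∣b∣≢1 (coprime (ℕ.∣-refl , ∣⇒∣ᵤ (subst (b ∣_) (ℤ.neg-involutive a) (∣m⇒∣-m b∣-a))))
  ∤chebyshev {a} {b} coprime ∣b∣≢1 (suc t) b∣c =
    ∤chebyshev coprime ∣b∣≢1 t
      (∣ᵤ⇒∣ (coprime-divisor b a c′ coprime (∣⇒∣ᵤ b∣ac′)))
    where
    c  = chebyshev a b t
    c′ = chebyshev a b (suc t)
    eq : ∀ a b c c′ → - (- a * c′ - b * b * c + b * (b * c)) ≡ a * c′
    eq = solve-∀
    b∣ac′ : b ∣ a * c′
    b∣ac′ = subst (b ∣_) (eq a b c c′)
      (∣m⇒∣-m (∣m∣n⇒∣m+n b∣c (∣m⇒∣m*n (b * c) ∣-refl)))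

  -- The recursion matrix has determinant b², hence scales by b² its invariant
  -- quadratic form.  Completing the square in this identity is what bounds
  -- |T_t| by 1 on the interval [-1,1].
  chebyshev-norm : ∀ a b t →
    let c = chebyshev a b t ; c′ = chebyshev a b (suc t) in
    c′ * c′ + a * (c′ * c) + b * b * (c * c) ≡
    b ^ t * b ^ t * (+ 4 * (b * b) - a * a)
  chebyshev-norm a b zero = eq a b
    where
    eq : ∀ a b → - a * - a + a * (- a * + 2) + b * b * (+ 2 * + 2) ≡
                 + 1 * + 1 * (+ 4 * (b * b) - a * a)
    eq = solve-∀
  chebyshev-norm a b (suc t) =
    trans (eq₁ a b _ _) (trans (cong (b * b *_) (chebyshev-norm a b t)) (eq₂ b (b ^ t) _))
    where
    eq₁ : ∀ a b c c′ → let c″ = - a * c′ - b * b * c in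
      c″ * c″ + a * (c″ * c′) + b * b * (c′ * c′) ≡
      b * b * (c′ * c′ + a * (c′ * c) + b * b * (c * c))
    eq₁ = solve-∀
    eq₂ : ∀ b p e → b * b * (p * p * e) ≡ b * p * (b * p) * e
    eq₂ = solve-∀

  0≤i*i : ∀ i → + 0 ≤ i * i
  0≤i*i (+ n)    = subst (+ 0 ≤_) (ℤ.pos-* n n) (ℤ.+≤+ ℕ.z≤n)
  0≤i*i -[1+ n ] = ℤ.+≤+ ℕ.z≤n

  chebyshev²≤ : ∀ a b t → + 0 < + 4 * (b * b) - a * a →
    let c = chebyshev a b t ; p = + 2 * b ^ t in c * c ≤ p * p
  chebyshev²≤ a b t 0<e = ℤ.*-cancelˡ-≤-pos _ _ e {{ℤ.positive 0<e}} (begin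
    e * (c * c)                  ≡⟨ ℤ.+-identityˡ _ ⟨
    + 0 + e * (c * c)            ≤⟨ ℤ.+-monoˡ-≤ (e * (c * c)) (0≤i*i (+ 2 * c′ + a * c)) ⟩
    (+ 2 * c′ + a * c) * (+ 2 * c′ + a * c) + e * (c * c) ≡⟨ eq₁ a b c c′ ⟩
    + 4 * (c′ * c′ + a * (c′ * c) + b * b * (c * c)) ≡⟨ cong (+ 4 *_) (chebyshev-norm a b t) ⟩
    + 4 * (b ^ t * b ^ t * e)   ≡⟨ eq₂ (b ^ t) e ⟩
    e * (+ 2 * b ^ t * (+ 2 * b ^ t)) ∎)
    where
    open ℤ.≤-Reasoning
    c  = chebyshev a b t
    c′ = chebyshev a b (suc t)
    e = + 4 * (b * b) - a * a
    eq₁ : ∀ a b c c′ →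
      (+ 2 * c′ + a * c) * (+ 2 * c′ + a * c) + (+ 4 * (b * b) - a * a) * (c * c) ≡
      + 4 * (c′ * c′ + a * (c′ * c) + b * b * (c * c))
    eq₁ = solve-∀
    eq₂ : ∀ p e → + 4 * (p * p * e) ≡ e * (+ 2 * p * (+ 2 * p))
    eq₂ = solve-∀

  square-cancel-≤ : ∀ i n → i * i ≤ + n * + n → i ≤ + n × - (+ n) ≤ i
  square-cancel-≤ (+ m) n m²≤n² = ℤ.+≤+ m≤n , ℤ.≤-trans (ℤ.neg-mono-≤ (ℤ.+≤+ ℕ.z≤n)) (ℤ.+≤+ ℕ.z≤n)
    where
    m≤n : m ℕ.≤ n
    m≤n = ℕ.≮⇒≥ λ n<m → ℕ.<⇒≱ (ℕ.*-mono-< n<m n<m)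
      (ℤ.drop‿+≤+ (subst₂ _≤_ (sym (ℤ.pos-* m m)) (sym (ℤ.pos-* n n)) m²≤n²))
  square-cancel-≤ -[1+ m ] n m²≤n² = ℤ.-≤+ , ℤ.neg-mono-≤ (ℤ.+≤+ m≤n)
    where
    m≤n : suc m ℕ.≤ n
    m≤n = ℕ.≮⇒≥ λ n<m → ℕ.<⇒≱ (ℕ.*-mono-< n<m n<m)
      (ℤ.drop‿+≤+ (subst (_ ≤_) (sym (ℤ.pos-* n n)) m²≤n²))

  -- The fraction 2/d in lowest terms is a/b.  It is not an integer for d > 2.
  lowestTerms : ∀ d → 2 ℕ.< d →
    ∃[ a ] ∃[ b ] ℕ.Coprime b a × 1 ℕ.< b × 2 ℕ.* b ≡ a ℕ.* d
  lowestTerms d 2<d = 2 ℕ./ g , d ℕ./ g , ℕ.sym (ℕ.coprime-/gcd 2 d) , 1<b , 2b≡ad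
    where
    g = ℕ.gcd 2 d
    instance
      g≢0 : ℕ.NonZero g
      g≢0 = ℕ.≢-nonZero (ℕ.gcd[m,n]≢0 2 d (inj₁ λ ()))
    a = 2 ℕ./ g
    b = d ℕ./ g
    ag≡2 : a ℕ.* g ≡ 2
    ag≡2 = ℕ.m/n*n≡m (ℕ.gcd[m,n]∣m 2 d)
    bg≡d : b ℕ.* g ≡ d
    bg≡d = ℕ.m/n*n≡m (ℕ.gcd[m,n]∣n 2 d)
    2b≡ad : 2 ℕ.* b ≡ a ℕ.* d
    2b≡ad = begin
      2 ℕ.* b           ≡⟨ cong (ℕ._* b) ag≡2 ⟨
      a ℕ.* g ℕ.* b     ≡⟨ ℕ.*-assoc a g b ⟩
      a ℕ.* (g ℕ.* b)   ≡⟨ cong (a ℕ.*_) (ℕ.*-comm g b) ⟩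
      a ℕ.* (b ℕ.* g)   ≡⟨ cong (a ℕ.*_) bg≡d ⟩
      a ℕ.* d           ∎
      where
      open ≡-Reasoning
    g≤2 : g ℕ.≤ 2
    g≤2 = ℕ.∣⇒≤ (ℕ.gcd[m,n]∣m 2 d)
    1<b : 1 ℕ.< b
    1<b = ℕ.≰⇒> λ b≤1 → ℕ.<⇒≱ 2<d (subst (ℕ._≤ 2) bg≡d (ℕ.*-mono-≤ b≤1 g≤2))

  pos-^ : ∀ b t → (+ b) ^ t ≡ + (b ℕ.^ t)
  pos-^ b zero    = refl
  pos-^ b (suc t) = trans (cong (+ b *_) (pos-^ b t)) (sym (ℤ.pos-* b (b ℕ.^ t)))

  pos-2*^ : ∀ b t → + 2 * (+ b) ^ t ≡ + (2 ℕ.* b ℕ.^ t)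
  pos-2*^ b t = trans (cong (+ 2 *_) (pos-^ b t)) (sym (ℤ.pos-* 2 (b ℕ.^ t)))

  ∣chebyshev∣≤ : ∀ a b t → a ℕ.< 2 ℕ.* b →
    let c = chebyshev (+ a) (+ b) t ; p = + 2 * (+ b) ^ t in c ≤ p × - p ≤ c
  ∣chebyshev∣≤ a b t a<2b = subst (λ p → c ≤ p × - p ≤ c) (sym (pos-2*^ b t))
    (square-cancel-≤ c _ (subst (λ p → c * c ≤ p * p) (pos-2*^ b t)
      (chebyshev²≤ (+ a) (+ b) t 0<e)))
    where
    c = chebyshev (+ a) (+ b) t
    2b*2b : ∀ b → + 2 * b * (+ 2 * b) ≡ + 4 * (b * b)
    2b*2b = solve-∀
    a²<4b² : + a * + a < + 4 * (+ b * + b)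
    a²<4b² = subst₂ _<_ (ℤ.pos-* a a)
      (trans (ℤ.pos-* (2 ℕ.* b) (2 ℕ.* b))
        (trans (cong₂ _*_ (ℤ.pos-* 2 b) (ℤ.pos-* 2 b)) (2b*2b (+ b))))
      (ℤ.+<+ (ℕ.*-mono-< a<2b a<2b))
    0<e : + 0 < + 4 * (+ b * + b) - + a * + a
    0<e = subst (_< + 4 * (+ b * + b) - + a * + a) (ℤ.+-inverseʳ (+ a * + a))
      (ℤ.+-monoˡ-< (- (+ a * + a)) a²<4b²)

  -- This sequence is 2cos(2πt/3), which runs through 2, -1, -1 periodically.
  chebyshev-1-1≢-2 : ∀ t → chebyshev (+ 1) (+ 1) t ≢ - + 2
  chebyshev-1-1≢-2 t eq with orbit t
    where
    c = chebyshev (+ 1) (+ 1)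
    recurrence : ℤ → ℤ → ℤ
    recurrence x y = - + 1 * y - + 1 * + 1 * x
    orbit : ∀ t → (c t ≡ + 2   × c (suc t) ≡ - + 1) ⊎
                  (c t ≡ - + 1 × c (suc t) ≡ - + 1) ⊎
                  (c t ≡ - + 1 × c (suc t) ≡ + 2)
    orbit zero = inj₁ (refl , refl)
    orbit (suc t) with orbit t
    ... | inj₁ (p , q)        = inj₂ (inj₁ (q , cong₂ recurrence p q))
    ... | inj₂ (inj₁ (p , q)) = inj₂ (inj₂ (q , cong₂ recurrence p q))
    ... | inj₂ (inj₂ (p , q)) = inj₁ (q , cong₂ recurrence p q)
  ... | inj₁ (p , _)        = case trans (sym p) eq of λ ()
  ... | inj₂ (inj₁ (p , _)) = case trans (sym p) eq of λ ()
  ... | inj₂ (inj₂ (p , _)) = case trans (sym p) eq of λ ()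

  -- The cosine T_t(-1/d) as a fraction numerator t / denominator t of integers,
  -- with what is needed about its values.  The argument -1/d is written -a/2b.
  -- The value 1 recurs for d = 2 (at multiples of 3), hence the condition 2 < d in
  -- the last field; the value -1 never occurs.
  record RescaledChebyshev (d : ℕ) : Set where
    field
      a b    : ℕ
      2b≡ad  : 2 ℕ.* b ≡ a ℕ.* d
    numerator : ℕ → ℤ
    numerator t = chebyshev (+ a) (+ b) t
    denominator : ℕ → ℤ
    denominator t = + 2 * (+ b) ^ t
    field
      0<denominator          : ∀ t → + 0 < denominator t
      numerator≤denominator  : ∀ t → numerator t ≤ denominator t
      -denominator≤numerator : ∀ t → - denominator t ≤ numerator t
      numerator≢-denominator : ∀ t → 1 ℕ.≤ t → numerator t ≢ - denominator t
      numerator≢denominator  : 2 ℕ.< d → ∀ t → 1 ℕ.≤ t → numerator t ≢ denominator t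

  0<2*b^ : ∀ b .{{_ : ℕ.NonZero b}} t → + 0 < + 2 * (+ b) ^ t
  0<2*b^ b t = subst (+ 0 <_) (sym (pos-2*^ b t))
    (ℤ.+<+ (ℕ.*-mono-≤ {1} {2} (ℕ.s≤s ℕ.z≤n) (ℕ.m^n>0 b t)))

  -- For d > 2 the integer b exceeds 1 and divides 2 b^t at positive times, which
  -- excludes the values 1 and -1; for d = 2 it is 1, and the sequence is periodic.
  rescaledChebyshev : ∀ d → 2 ℕ.≤ d → RescaledChebyshev d
  rescaledChebyshev d 2≤d with ℕ.m≤n⇒m<n∨m≡n 2≤d
  ... | inj₂ refl = record
    { a = 1 ; b = 1 ; 0<denominator = 0<2*b^ 1 ; 2b≡ad = refl
    ; numerator≢-denominator = λ t _ eq → chebyshev-1-1≢-2 t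
        (trans eq (cong (λ x → - (+ 2 * x)) (trans (pos-^ 1 t) (cong +_ (ℕ.^-zeroˡ t)))))
    ; numerator≢denominator = λ 2<2 → ⊥-elim (ℕ.<-irrefl refl 2<2)
    ; numerator≤denominator = λ t → proj₁ (∣chebyshev∣≤ 1 1 t ℕ.≤-refl)
    ; -denominator≤numerator = λ t → proj₂ (∣chebyshev∣≤ 1 1 t ℕ.≤-refl)
    }
  ... | inj₁ 2<d with lowestTerms d 2<d
  ... | a , b , coprime , 1<b , 2b≡ad = record
    { a = a ; b = b ; 0<denominator = 0<2*b^ b {{ℕ.>-nonZero (ℕ.<⇒≤ 1<b)}} ; 2b≡ad = 2b≡ad
    ; numerator≢-denominator = λ { (suc t) _ eq →
        ∤chebyshev coprime b≢1 t (subst (+ b ∣_) (sym eq) (∣m⇒∣-m (b∣p t))) }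
    ; numerator≢denominator = λ { _ (suc t) _ eq →
        ∤chebyshev coprime b≢1 t (subst (+ b ∣_) (sym eq) (b∣p t)) }
    ; numerator≤denominator = λ t → proj₁ (∣chebyshev∣≤ a b t a<2b)
    ; -denominator≤numerator = λ t → proj₂ (∣chebyshev∣≤ a b t a<2b)
    }
    where
    b≢1 : b ≢ 1
    b≢1 eq = ℕ.<-irrefl (sym eq) 1<b
    b∣p : ∀ t → + b ∣ + 2 * (+ b) ^ suc t
    b∣p t = ∣n⇒∣m*n (+ 2) (∣m⇒∣m*n ((+ b) ^ t) ∣-refl)
    a≢0 : a ≢ 0
    a≢0 refl = ℕ.<-irrefl (sym 2b≡ad) (ℕ.≤-trans (ℕ.<⇒≤ 1<b) (ℕ.m≤m+n b _))
    a<2b : a ℕ.< 2 ℕ.* b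
    a<2b = subst (a ℕ.<_) (sym 2b≡ad) (ℕ.m<m*n a d {{ℕ.≢-nonZero a≢0}} 2≤d)

open IntegerSequence

-- Consequences of the axioms of the real numbers
module RealProperties {c ℓ₁ ℓ₂} (ℝ : RealNumbers c ℓ₁ ℓ₂) where
  open RealNumbers ℝ
  open CommutativeRing commutativeRing public using (refl; sym; trans)
  open RingProperties ring public using (-‿distribˡ-*; -‿distribʳ-*; -‿involutive; -0#≈0#; -‿+-comm)
  private module M = Mult semiring
  open import Relation.Binary.Reasoning.Setoid setoid

  -- Built on the multiplication that has 1 × x = x definitionally, so that the
  -- ring solver's constants 0, 1 and 2 are 0#, 1# and 1# + 1#.
  fromℤ : ℤ → Carrier
  fromℤ (+ n)    = n M.× 1#
  fromℤ -[1+ n ] = - (suc n M.× 1#)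

  fromℕ≈fromℤ : ∀ n → fromℕ n ≈ fromℤ (+ n)
  fromℕ≈fromℤ n = M.×ᵤ≈× n 1#

  fromℤ-⊖ : ∀ m n → fromℤ (m ⊖ n) ≈ fromℤ (+ m) - fromℤ (+ n)
  fromℤ-⊖ m zero = sym (trans (+-congˡ -0#≈0#) (+-identityʳ _))
  fromℤ-⊖ zero (suc n) = sym (+-identityˡ _)
  fromℤ-⊖ (suc m) (suc n) = begin
    fromℤ (suc m ⊖ suc n)              ≡⟨ ≡.cong fromℤ (ℤ.[1+m]⊖[1+n]≡m⊖n m n) ⟩
    fromℤ (m ⊖ n)                      ≈⟨ fromℤ-⊖ m n ⟩
    x - y                              ≈⟨ +-congʳ (+-identityˡ x) ⟨
    0# + x - y                         ≈⟨ +-congʳ (+-congʳ (-‿inverseʳ 1#)) ⟨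
    1# - 1# + x - y                    ≈⟨ +-congʳ (+-assoc 1# (- 1#) x) ⟩
    1# + (- 1# + x) - y                ≈⟨ +-congʳ (+-congˡ (+-comm (- 1#) x)) ⟩
    1# + (x - 1#) - y                  ≈⟨ +-congʳ (+-assoc 1# x (- 1#)) ⟨
    1# + x - 1# - y                    ≈⟨ +-assoc (1# + x) (- 1#) (- y) ⟩
    1# + x + (- 1# - y)                ≈⟨ +-congˡ (-‿+-comm 1# y) ⟩
    1# + x - (1# + y)                  ≈⟨ +-cong (M.1+× m 1#) (-‿cong (M.1+× n 1#)) ⟨
    fromℤ (+ suc m) - fromℤ (+ suc n)  ∎
    where
    x = fromℤ (+ m)
    y = fromℤ (+ n)

  fromℤ-neg : ∀ i → fromℤ (ℤ.- i) ≈ - fromℤ i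
  fromℤ-neg (+ zero)  = sym -0#≈0#
  fromℤ-neg (+ suc n) = refl
  fromℤ-neg -[1+ n ]  = sym (-‿involutive _)

  fromℤ-+ : ∀ i j → fromℤ (i ℤ.+ j) ≈ fromℤ i + fromℤ j
  fromℤ-+ (+ m)    (+ n)    = M.×-homo-+ 1# m n
  fromℤ-+ (+ m)    -[1+ n ] = fromℤ-⊖ m (suc n)
  fromℤ-+ -[1+ m ] (+ n)    = trans (fromℤ-⊖ n (suc m)) (+-comm _ _)
  fromℤ-+ -[1+ m ] -[1+ n ] = begin
    - (suc (suc (m ℕ.+ n)) M.× 1#)        ≡⟨ ≡.cong (λ k → - (suc k M.× 1#)) (ℕ.+-suc m n) ⟨
    - ((suc m ℕ.+ suc n) M.× 1#)          ≈⟨ -‿cong (M.×-homo-+ 1# (suc m) (suc n)) ⟩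
    - (suc m M.× 1# + suc n M.× 1#)       ≈⟨ -‿+-comm _ _ ⟨
    - (suc m M.× 1#) - (suc n M.× 1#)     ∎

  fromℤ-+* : ∀ m j → fromℤ (+ m ℤ.* j) ≈ fromℤ (+ m) * fromℤ j
  fromℤ-+* m (+ n) = trans (reflexive (≡.cong fromℤ (≡.sym (ℤ.pos-* m n)))) (M.×1-homo-* m n)
  fromℤ-+* m -[1+ n ] = begin
    fromℤ (+ m ℤ.* -[1+ n ])          ≡⟨ ≡.cong fromℤ (ℤ.neg-distribʳ-* (+ m) (+ suc n)) ⟨
    fromℤ (ℤ.- (+ m ℤ.* + suc n))     ≈⟨ fromℤ-neg (+ m ℤ.* + suc n) ⟩
    - fromℤ (+ m ℤ.* + suc n)         ≈⟨ -‿cong (fromℤ-+* m (+ suc n)) ⟩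
    - (fromℤ (+ m) * fromℤ (+ suc n)) ≈⟨ -‿distribʳ-* _ _ ⟩
    fromℤ (+ m) * - fromℤ (+ suc n)   ∎

  fromℤ-* : ∀ i j → fromℤ (i ℤ.* j) ≈ fromℤ i * fromℤ j
  fromℤ-* (+ m)    j = fromℤ-+* m j
  fromℤ-* -[1+ m ] j = begin
    fromℤ (-[1+ m ] ℤ.* j)            ≡⟨ ≡.cong fromℤ (ℤ.neg-distribˡ-* (+ suc m) j) ⟨
    fromℤ (ℤ.- (+ suc m ℤ.* j))       ≈⟨ fromℤ-neg (+ suc m ℤ.* j) ⟩
    - fromℤ (+ suc m ℤ.* j)           ≈⟨ -‿cong (fromℤ-+* (suc m) j) ⟩
    - (fromℤ (+ suc m) * fromℤ j)     ≈⟨ -‿distribˡ-* _ _ ⟩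
    - fromℤ (+ suc m) * fromℤ j       ∎

  private
    ℤ→ℝ : ℤ.+-*-rawRing -Raw-AlmostCommutative⟶ fromCommutativeRing commutativeRing
    ℤ→ℝ = record
      { ⟦_⟧ = fromℤ ; +-homo = fromℤ-+ ; *-homo = fromℤ-* ; -‿homo = fromℤ-neg
      ; 0-homo = refl ; 1-homo = refl }

    fromℤ-≟ : ∀ i j → Maybe (fromℤ i ≈ fromℤ j)
    fromℤ-≟ i j with i ℤ.≟ j
    ... | yes i≡j = just (reflexive (≡.cong fromℤ i≡j))
    ... | no  _   = nothing

  open RingSolver ℤ.+-*-rawRing (fromCommutativeRing commutativeRing) ℤ→ℝ
    fromℤ-≟
    public using (solve; con; _:=_; _:+_; _:*_; _:-_; :-_)

  -- To prove l ≈ r from p ≈ q it suffices that l - r = c (p - q) is a ring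
  -- identity.  The two sides are arranged to avoid subtraction.
  linear-combination : ∀ {p q l r} c → p ≈ q → l + c * q ≈ r + c * p → l ≈ r
  linear-combination {p} {q} {l} {r} c p≈q eq = begin
    l                      ≈⟨ solve 2 (λ l x → l := l :+ x :- x) refl l (c * q) ⟩
    l + c * q - c * q      ≈⟨ +-congʳ eq ⟩
    r + c * p - c * q      ≈⟨ +-congʳ (+-congˡ (*-congˡ p≈q)) ⟩
    r + c * q - c * q      ≈⟨ solve 2 (λ l x → l := l :+ x :- x) refl r (c * q) ⟨
    r                      ∎

  inverse-unique : ∀ {x y z} → x * y ≈ 1# → x * z ≈ 1# → y ≈ z
  inverse-unique {x} {y} {z} xy≈1 xz≈1 = begin
    y            ≈⟨ *-identityʳ y ⟨
    y * 1#       ≈⟨ *-congˡ xz≈1 ⟨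
    y * (x * z)  ≈⟨ solve 3 (λ x y z → y :* (x :* z) := x :* y :* z) refl x y z ⟩
    x * y * z    ≈⟨ *-congʳ xy≈1 ⟩
    1# * z       ≈⟨ *-identityˡ z ⟩
    z            ∎

  #⇒*-cancelˡ : ∀ {x y z} → x # 0# → x * y ≈ x * z → y ≈ z
  #⇒*-cancelˡ {x} {y} {z} x#0 xy≈xz with k , xk≈1 ← inverse x#0 = begin
    y            ≈⟨ *-identityˡ y ⟨
    1# * y       ≈⟨ *-congʳ xk≈1 ⟨
    x * k * y    ≈⟨ solve 3 (λ x k y → x :* k :* y := k :* (x :* y)) refl x k y ⟩
    k * (x * y)  ≈⟨ *-congˡ xy≈xz ⟩
    k * (x * z)  ≈⟨ solve 3 (λ x k y → x :* k :* y := k :* (x :* y)) refl x k z ⟨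
    x * k * z    ≈⟨ *-congʳ xk≈1 ⟩
    1# * z       ≈⟨ *-identityˡ z ⟩
    z            ∎

  <-asym : ∀ {x y} → x < y → ¬ (y < x)
  <-asym x<y y<x = <-irrefl refl (<-trans x<y y<x)

  <⇒≤ : ∀ {x y} → x < y → x ≤ y
  <⇒≤ = <-asym

  ≤-reflexive : ∀ {x y} → x ≈ y → x ≤ y
  ≤-reflexive x≈y y<x = <-irrefl (sym x≈y) y<x

  ≤-<-trans : ∀ {x y z} → x ≤ y → y < z → x < z
  ≤-<-trans {x} x≤y y<z with <-cotransitive y<z x
  ... | inj₁ y<x = contradiction y<x x≤y
  ... | inj₂ x<z = x<z

  ≤-trans : ∀ {x y z} → x ≤ y → y ≤ z → x ≤ z
  ≤-trans x≤y y≤z z<x = x≤y (≤-<-trans y≤z z<x)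

  ≤-antisym : ∀ {x y} → x ≤ y → y ≤ x → x ≈ y
  ≤-antisym x≤y y≤x = #-tight λ { (inj₁ x<y) → y≤x x<y ; (inj₂ y<x) → x≤y y<x }

  x<y⇒0<y-x : ∀ {x y} → x < y → 0# < y - x
  x<y⇒0<y-x {x} x<y = <-respˡ-≈ (-‿inverseʳ x) (+-monoˡ-< (- x) x<y)

  0<y-x⇒x<y : ∀ {x y} → 0# < y - x → x < y
  0<y-x⇒x<y {x} {y} 0<y-x =
    <-respˡ-≈ (+-identityˡ x)
      (<-respʳ-≈ (solve 2 (λ x y → y :- x :+ x := y) refl x y) (+-monoˡ-< x 0<y-x))

  +-monoˡ-≤ : ∀ {x y} z → x ≤ y → x + z ≤ y + z
  +-monoˡ-≤ {x} {y} z x≤y y+z<x+z = x≤y (0<y-x⇒x<y (<-respʳ-≈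
    (solve 3 (λ x y z → x :+ z :- (y :+ z) := x :- y) refl x y z) (x<y⇒0<y-x y+z<x+z)))

  +-monoʳ-≤ : ∀ {x y} z → x ≤ y → z + x ≤ z + y
  +-monoʳ-≤ z x≤y = 
    ≤-trans (≤-reflexive (+-comm _ _)) (≤-trans (+-monoˡ-≤ z x≤y) (≤-reflexive (+-comm _ _)))

  +-mono-≤ : ∀ {w x y z} → w ≤ x → y ≤ z → w + y ≤ x + z
  +-mono-≤ w≤x y≤z = ≤-trans (+-monoˡ-≤ _ w≤x) (+-monoʳ-≤ _ y≤z)

  *-monoʳ-< : ∀ {x y} z → 0# < z → x < y → z * x < z * y
  *-monoʳ-< {x} {y} z 0<z x<y = 0<y-x⇒x<y (<-respʳ-≈
    (solve 3 (λ x y z → z :* (y :- x) := z :* y :- z :* x) refl x y z) (*-positive 0<z (x<y⇒0<y-x x<y)))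

  -- If z y < z x, then x < y is impossible as well, so x ≤ y gives x ≈ y.  This
  -- avoids cancelling z, and thereby the positivity of inverses.
  *-monoʳ-≤ : ∀ {x y} z → 0# < z → x ≤ y → z * x ≤ z * y
  *-monoʳ-≤ z 0<z x≤y zy<zx = contradiction
    (≤-antisym x≤y λ x<y → <-asym zy<zx (*-monoʳ-< z 0<z x<y))
    (λ x≈y → <-irrefl (*-congˡ (sym x≈y)) zy<zx)

  abs-nonneg : ∀ x → 0# ≤ abs x
  abs-nonneg x |x|<0 = <-irrefl (-‿inverseʳ x) (<-trans
    (<-respʳ-≈ (+-identityˡ (- x)) (+-monoˡ-< (- x) (≤-<-trans (x≤x∨y x (- x)) |x|<0)))
    (≤-<-trans (y≤x∨y x (- x)) |x|<0))

  0≤x⇒abs≤x : ∀ {x} → 0# ≤ x → abs x ≤ x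
  0≤x⇒abs≤x {x} 0≤x = ∨-least (≤-reflexive refl) (≤-trans -x≤0 0≤x)
    where
    -x≤0 : - x ≤ 0#
    -x≤0 0<-x = 0≤x (<-respˡ-≈ (+-identityˡ x)
      (<-respʳ-≈ (-‿inverseˡ x) (+-monoˡ-< x 0<-x)))

  0<fromℤ : ∀ n → 0# < fromℤ (+ suc n)
  0<fromℤ n = <-respʳ-≈ (fromℕ≈fromℤ (suc n)) (0<fromℕ-suc n)

  fromℤ-mono-< : ∀ {i j} → i ℤ.< j → fromℤ i < fromℤ j
  fromℤ-mono-< {i} {j} i<j = 0<y-x⇒x<y 
    (<-respʳ-≈ (trans (fromℤ-+ j (ℤ.- i)) (+-congˡ (fromℤ-neg i))) (pos (j ℤ.- i) 0<j-i))
    where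
    0<j-i : + 0 ℤ.< j ℤ.- i
    0<j-i = ≡.subst (ℤ._< j ℤ.- i) (ℤ.+-inverseʳ i) (ℤ.+-monoˡ-< (ℤ.- i) i<j)
    pos : ∀ k → + 0 ℤ.< k → 0# < fromℤ k
    pos (+ suc n) _ = 0<fromℤ n
    pos (+ zero) (ℤ.+<+ ())

  fromℤ-mono-≤ : ∀ {i j} → i ℤ.≤ j → fromℤ i ≤ fromℤ j
  fromℤ-mono-≤ {i} {j} i≤j j<i with ℤ.<-cmp i j
  ... | tri< i<j _ _ = <-asym (fromℤ-mono-< i<j) j<i
  ... | tri≈ _ ≡.refl _ = <-irrefl refl j<i
  ... | tri> _ _ j<i′ = ℤ.<⇒≱ j<i′ i≤j

  fromℤ-injective : ∀ {i j} → fromℤ i ≈ fromℤ j → i ≡ j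
  fromℤ-injective {i} {j} eq with ℤ.<-cmp i j
  ... | tri< i<j _ _ = contradiction (fromℤ-mono-< i<j) (<-irrefl eq)
  ... | tri≈ _ i≡j _ = i≡j
  ... | tri> _ _ j<i = contradiction (fromℤ-mono-< j<i) (<-irrefl (sym eq))

  √1≈1 : √ 1# ≈ 1#
  √1≈1 = #⇒*-cancelˡ (inj₂ 0<√1+1)
    (linear-combination 1# (√-square (<⇒≤ 0<1))
      (solve 1 (λ r → (r :+ con (+ 1)) :* r :+ con (+ 1) :* con (+ 1) :=
                      (r :+ con (+ 1)) :* con (+ 1) :+ con (+ 1) :* (r :* r)) refl (√ 1#)))
    where
    0<√1+1 : 0# < √ 1# + 1#
    0<√1+1 = <-trans 0<1 (<-respˡ-≈ (+-identityˡ 1#) (+-monoˡ-< 1# (√-positive 0<1)))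

-- Finite sums
module SumProperties {c ℓ₁ ℓ₂} (ℝ : RealNumbers c ℓ₁ ℓ₂) where
  open RealNumbers ℝ
  open LinearAlgebra ℝ
  open RealProperties ℝ
  private module S = SemiringSum semiring
  open import Relation.Binary.Reasoning.Setoid setoid

  private variable I J : Set

  -- The sum ∑ of a finite type is sumₗ enum by definition; the summation lemmas
  -- are proved for arbitrary lists.
  sumₗ : List I → (I → Carrier) → Carrier
  sumₗ xs f = foldr (λ i s → f i + s) 0# xs

  sumₗ-cong : ∀ {f g : I → Carrier} xs → (∀ i → f i ≈ g i) → sumₗ xs f ≈ sumₗ xs g
  sumₗ-cong []       f≈g = refl
  sumₗ-cong (x ∷ xs) f≈g = +-cong (f≈g x) (sumₗ-cong xs f≈g)

  sumₗ-0 : ∀ (xs : List I) → sumₗ xs (λ _ → 0#) ≈ 0#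
  sumₗ-0 []       = refl
  sumₗ-0 (x ∷ xs) = trans (+-identityˡ _) (sumₗ-0 xs)

  sumₗ-+ : ∀ (f g : I → Carrier) xs → sumₗ xs (λ i → f i + g i) ≈ sumₗ xs f + sumₗ xs g
  sumₗ-+ f g []       = sym (+-identityˡ 0#)
  sumₗ-+ f g (x ∷ xs) = trans (+-congˡ (sumₗ-+ f g xs))
    (solve 4 (λ a b c d → a :+ b :+ (c :+ d) := a :+ c :+ (b :+ d)) refl (f x) (g x) _ _)

  sumₗ-*ˡ : ∀ k (f : I → Carrier) xs → sumₗ xs (λ i → k * f i) ≈ k * sumₗ xs f
  sumₗ-*ˡ k f []       = sym (zeroʳ k)
  sumₗ-*ˡ k f (x ∷ xs) = trans (+-congˡ (sumₗ-*ˡ k f xs)) (sym (distribˡ k _ _))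

  sumₗ-swap : ∀ (f : I → J → Carrier) xs ys →
    sumₗ xs (λ i → sumₗ ys (f i)) ≈ sumₗ ys (λ j → sumₗ xs (λ i → f i j))
  sumₗ-swap f []       ys = sym (sumₗ-0 ys)
  sumₗ-swap f (x ∷ xs) ys = trans (+-congˡ (sumₗ-swap f xs ys)) (sym (sumₗ-+ _ _ ys))

  sumₗ-++ : ∀ (f : I → Carrier) xs ys → sumₗ (xs ++ ys) f ≈ sumₗ xs f + sumₗ ys f
  sumₗ-++ f []       ys = sym (+-identityˡ _)
  sumₗ-++ f (x ∷ xs) ys = trans (+-congˡ (sumₗ-++ f xs ys)) (sym (+-assoc _ _ _))

  sumₗ-concatMap : ∀ (f : J → Carrier) (g : I → List J) xs →
    sumₗ (concatMap g xs) f ≈ sumₗ xs (λ i → sumₗ (g i) f)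
  sumₗ-concatMap f g []       = refl
  sumₗ-concatMap f g (x ∷ xs) = trans (sumₗ-++ f (g x) _) (+-congˡ (sumₗ-concatMap f g xs))

  sumₗ-mapMaybe : ∀ (f : J → Carrier) (g : I → Maybe J) xs →
    sumₗ (mapMaybe g xs) f ≈ sumₗ xs (λ i → maybe′ f 0# (g i))
  sumₗ-mapMaybe f g []       = refl
  sumₗ-mapMaybe f g (x ∷ xs) with g x
  ... | just y  = +-congˡ (sumₗ-mapMaybe f g xs)
  ... | nothing = trans (sumₗ-mapMaybe f g xs) (sym (+-identityˡ _))

  sumₗ-tabulate : ∀ {n} (f : I → Carrier) (g : Fin n → I) → sumₗ (tabulate g) f ≡ S.sum (f ∘ g)
  sumₗ-tabulate {n = zero}  f g = ≡.refl
  sumₗ-tabulate {n = suc n} f g = ≡.cong (λ z → f (g zero) + z) (sumₗ-tabulate f (g ∘ suc))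

  module _ {{_ : Finite I}} where
    ∑-cong : {f g : I → Carrier} → (∀ i → f i ≈ g i) → ∑ f ≈ ∑ g
    ∑-cong = sumₗ-cong enum

    ∑-+ : ∀ (f g : I → Carrier) → ∑ (λ i → f i + g i) ≈ ∑ f + ∑ g
    ∑-+ f g = sumₗ-+ f g enum

    ∑-*ˡ : ∀ k (f : I → Carrier) → ∑ (λ i → k * f i) ≈ k * ∑ f
    ∑-*ˡ k f = sumₗ-*ˡ k f enum

    ∑-swap : {{_ : Finite J}} (f : I → J → Carrier) → ∑ (λ i → ∑ (f i)) ≈ ∑ (λ j → ∑ (λ i → f i j))
    ∑-swap f = sumₗ-swap f enum enum

  ∑-Fin : ∀ {n} (f : Fin n → Carrier) → ∑ f ≈ S.sum f
  ∑-Fin f = reflexive (sumₗ-tabulate f id)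

  ∑-const : ∀ n x → ∑ {Fin n} (λ _ → x) ≈ fromℕ n * x
  ∑-const n x = trans (∑-Fin {n} (λ _ → x)) (lemma n)
    where
    lemma : ∀ n → S.sum {n} (λ _ → x) ≈ fromℕ n * x
    lemma zero    = sym (zeroˡ x)
    lemma (suc n) = trans (+-cong (sym (*-identityˡ x)) (lemma n)) (sym (distribʳ x 1# (fromℕ n)))

  -- The row of the identity matrix at i evaluates functions at i.
  ∑-δ : ∀ {n} (i : Fin n) (f : Fin n → Carrier) → ∑ (λ j → 1ᴹ i j * f j) ≈ f i
  ∑-δ i f = trans (∑-Fin (λ j → 1ᴹ i j * f j)) (lemma i f)
    where
    zeros : ∀ {n} (f : Fin n → Carrier) → S.sum (λ j → 0# * f j) ≈ 0#
    zeros {zero}  f = refl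
    zeros {suc n} f = trans (+-cong (zeroˡ _) (zeros (f ∘ suc))) (+-identityˡ 0#)
    lemma : ∀ {n} (i : Fin n) (f : Fin n → Carrier) → S.sum (λ j → 1ᴹ i j * f j) ≈ f i
    lemma zero    f = trans (+-cong (*-identityˡ _) (zeros (f ∘ suc))) (+-identityʳ _)
    lemma (suc i) f = trans (+-cong (zeroˡ _) (lemma i (f ∘ suc))) (+-identityˡ _)

  ∑-nonneg : ∀ {n} {f : Fin n → Carrier} → (∀ i → 0# ≤ f i) → 0# ≤ ∑ f
  ∑-nonneg {n} {f} 0≤f = ≤-trans (lemma f 0≤f) (≤-reflexive (sym (∑-Fin f)))
    where
    lemma : ∀ {n} (f : Fin n → Carrier) → (∀ i → 0# ≤ f i) → 0# ≤ S.sum f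
    lemma {zero}  f 0≤f = ≤-reflexive refl
    lemma {suc n} f 0≤f = ≤-trans (≤-reflexive (sym (+-identityˡ 0#)))
      (+-mono-≤ (0≤f zero) (lemma (f ∘ suc) (0≤f ∘ suc)))

  twoTerms≤∑ : ∀ {n} {f : Fin n → Carrier} → (∀ i → 0# ≤ f i) → ∀ {i j} → i ≢ j → f i + f j ≤ ∑ f
  twoTerms≤∑ {f = f} 0≤f {i} {j} i≢j = ≤-trans (two f 0≤f i≢j) (≤-reflexive (sym (∑-Fin f)))
    where
    sum≥0 : ∀ {n} (f : Fin n → Carrier) → (∀ i → 0# ≤ f i) → 0# ≤ S.sum f
    sum≥0 f 0≤f = ≤-trans (∑-nonneg 0≤f) (≤-reflexive (∑-Fin f))
    one : ∀ {n} (f : Fin n → Carrier) → (∀ i → 0# ≤ f i) → ∀ i → f i ≤ S.sum f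
    one {suc n} f 0≤f i = ≤-trans (≤-reflexive (sym (+-identityʳ _))) (≤-trans
      (+-monoʳ-≤ (f i) (sum≥0 _ (0≤f ∘ punchIn i)))
      (≤-reflexive (sym (S.sum-remove {i = i} f))))
    two : ∀ {n} (f : Fin n → Carrier) → (∀ i → 0# ≤ f i) → ∀ {i j} → i ≢ j → f i + f j ≤ S.sum f
    two {suc n} f 0≤f {i} {j} i≢j = ≤-trans
      (+-monoʳ-≤ (f i) (≡.subst (λ k → f k ≤ _) (Fin.punchIn-punchOut i≢j)
        (one (f ∘ punchIn i) (0≤f ∘ punchIn i) _)))
      (≤-reflexive (sym (S.sum-remove {i = i} f)))

  *ᵛ-cong : ∀ {I J : Set} {{_ : Finite J}} (M : Matrix I J) {x y} → x ≈ᵛ y → M *ᵛ x ≈ᵛ M *ᵛ y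
  *ᵛ-cong {J = J} M x≈y i = ∑-cong {I = J} λ j → *-congˡ (x≈y j)

  *ᵛ-assoc : ∀ {I J K : Set} {{_ : Finite J}} {{_ : Finite K}}
    (M : Matrix I J) (M′ : Matrix J K) x → (M *ᴹ M′) *ᵛ x ≈ᵛ M *ᵛ (M′ *ᵛ x)
  *ᵛ-assoc {J = J} {K = K} M M′ x i = begin
    ∑ (λ k → (∑ λ j → M i j * M′ j k) * x k)   ≈⟨ ∑-cong (λ k → trans (*-comm _ _) (sym (∑-*ˡ {I = J} (x k) _))) ⟩
    ∑ (λ k → ∑ λ j → x k * (M i j * M′ j k))   ≈⟨ ∑-swap (λ k j → x k * (M i j * M′ j k)) ⟩
    ∑ (λ j → ∑ λ k → x k * (M i j * M′ j k))
      ≈⟨ ∑-cong (λ j → trans (∑-cong {I = K} λ k →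
           solve 3 (λ x m m′ → x :* (m :* m′) := m :* (m′ :* x)) refl (x k) (M i j) (M′ j k))
           (∑-*ˡ {I = K} (M i j) _)) ⟩
    ∑ (λ j → M i j * ∑ λ k → M′ j k * x k)     ∎

-- Sums over the arcs of a graph
module ArcSums {c ℓ₁ ℓ₂} (ℝ : RealNumbers c ℓ₁ ℓ₂) {n} (G : Graph n) where
  open RealNumbers ℝ
  open LinearAlgebra ℝ
  open RealProperties ℝ
  open SumProperties ℝ
  open Graph G
  open Arcs G
  open import Relation.Binary.Reasoning.Setoid setoid

  -- The matrix of values of an arc function, extended by zero to pairs of
  -- non-adjacent vertices.
  onEdges : (Arc → Carrier) → Fin n → Fin n → Carrier
  onEdges f u v with T? (adj u v)
  ... | yes uv = f (arc u v uv)
  ... | no  _  = 0#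

  onEdges-arc : ∀ f a → onEdges f (tail a) (head a) ≡ f a
  onEdges-arc f (arc u v uv) with T? (adj u v)
  ... | yes uv′ = ≡.cong (λ p → f (arc u v p)) (T-irrelevant uv′ uv)
  ... | no ¬uv  = ⊥-elim (¬uv uv)

  private
    -- The enumeration of the arcs as a filtered double loop over vertices; the
    -- filter itself is recovered by unification.
    enumeration : Σ (Fin n → Fin n → Maybe Arc) λ g →
      arcs ≡ concatMap (λ u → mapMaybe (g u) (allFin n)) (allFin n)
    enumeration = _ , ≡.refl

    arc? : Fin n → Fin n → Maybe Arc
    arc? = proj₁ enumeration

    maybe-arc? : ∀ f u v → maybe′ f 0# (arc? u v) ≡ onEdges f u v
    maybe-arc? f u v with T? (adj u v)
    ... | yes uv = ≡.refl
    ... | no  _  = ≡.refl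

  ∑-arcs : ∀ f → ∑ {Arc} f ≈ ∑ λ u → ∑ λ v → onEdges f u v
  ∑-arcs f = begin
    sumₗ arcs f
      ≈⟨ sumₗ-concatMap f (λ u → mapMaybe (arc? u) (allFin n)) (allFin n) ⟩
    ∑ (λ u → sumₗ (mapMaybe (arc? u) (allFin n)) f)
      ≈⟨ ∑-cong (λ u → sumₗ-mapMaybe f (arc? u) (allFin n)) ⟩
    ∑ (λ u → ∑ λ v → maybe′ f 0# (arc? u v))
      ≈⟨ ∑-cong (λ u → ∑-cong λ v → reflexive (maybe-arc? f u v)) ⟩
    ∑ (λ u → ∑ λ v → onEdges f u v) ∎

  -- As each arc is listed exactly once, the identity matrix on arcs acts as the
  -- identity.
  ∑-δᴬ : ∀ a (f : Arc → Carrier) → ∑ (λ b → 1ᴹ a b * f b) ≈ f a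
  ∑-δᴬ a f = begin
    ∑ (λ b → 1ᴹ a b * f b)                                          ≈⟨ ∑-arcs (λ b → 1ᴹ a b * f b) ⟩
    ∑ (λ u → ∑ λ v → onEdges (λ b → 1ᴹ a b * f b) u v)              ≈⟨ ∑-cong (λ u → ∑-cong λ v → factor a u v) ⟩
    ∑ (λ u → ∑ λ v → 1ᴹ (tail a) u * (1ᴹ (head a) v * onEdges f u v)) 
      ≈⟨ ∑-cong (λ u → ∑-*ˡ {I = Fin n} (1ᴹ (tail a) u) _) ⟩
    ∑ (λ u → 1ᴹ (tail a) u * ∑ λ v → 1ᴹ (head a) v * onEdges f u v) ≈⟨ ∑-δ (tail a) _ ⟩
    ∑ (λ v → 1ᴹ (head a) v * onEdges f (tail a) v)                  ≈⟨ ∑-δ (head a) _ ⟩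
    onEdges f (tail a) (head a)                                     ≡⟨ onEdges-arc f a ⟩
    f a                                                             ∎
    where
    factor : ∀ a u v → onEdges (λ b → 1ᴹ a b * f b) u v ≈ 1ᴹ (tail a) u * (1ᴹ (head a) v * onEdges f u v)
    factor (arc u′ v′ p) u v with T? (adj u v)
    ... | no _ = sym (trans (*-congˡ (zeroʳ _)) (zeroʳ _))
    ... | yes q with u′ Fin.≟ u | v′ Fin.≟ v
    ...   | yes ≡.refl | yes ≡.refl = sym (*-identityˡ _)
    ...   | yes ≡.refl | no _       = trans (zeroˡ _) (sym (trans (*-identityˡ _) (zeroˡ _)))
    ...   | no _       | yes _      = trans (zeroˡ _) (sym (zeroˡ _))
    ...   | no _       | no _       = trans (zeroˡ _) (sym (zeroˡ _))

-- The arc-reversal walk on an arbitrary graph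
module WalkProperties {c ℓ₁ ℓ₂} (ℝ : RealNumbers c ℓ₁ ℓ₂) {n} (G : Graph n) where
  open RealNumbers ℝ
  open LinearAlgebra ℝ
  open RealProperties ℝ
  open SumProperties ℝ
  open Graph G
  open Arcs G
  open ArcSums ℝ G
  open ArcReversalWalk ℝ G
  private module S = SemiringSum semiring
  open import Data.Fin.Subset using (∣_∣)
  open import Relation.Binary.Reasoning.Setoid setoid

  fromℕ-degree : ∀ v → fromℕ (degree v) ≈ ∑ λ w → if adj v w then 1# else 0#
  fromℕ-degree v = trans (lemma (adj v)) (sym (∑-Fin λ w → if adj v w then 1# else 0#))
    where
    lemma : ∀ {m} (p : Fin m → Bool) →
      fromℕ ∣ Vec.tabulate p ∣ ≈ S.sum λ w → if p w then 1# else 0#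
    lemma {zero}  p = refl
    lemma {suc m} p with p zero
    ... | true  = +-congˡ (lemma (p ∘ suc))
    ... | false = trans (lemma (p ∘ suc)) (sym (+-identityˡ _))

  1/√degree² : ∀ v → 1/√degree v * 1/√degree v * fromℕ (degree v) ≈ 1#
  1/√degree² v = begin
    w * w * D          ≈⟨ *-congˡ (√-square (<⇒≤ 0<D)) ⟨
    w * w * (√ D * √ D) ≈⟨ solve 2 (λ w r → w :* w :* (r :* r) := r :* w :* (r :* w)) refl w (√ D) ⟩
    √ D * w * (√ D * w) ≈⟨ *-cong √D*w≈1 √D*w≈1 ⟩
    1# * 1#            ≈⟨ *-identityˡ 1# ⟩
    1#                 ∎
    where
    w = 1/√degree v
    D = fromℕ (degree v)
    0<D = 0<fromℕ (degree v) {{degree-nonZero v}}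
    √D*w≈1 : √ D * w ≈ 1#
    √D*w≈1 = proj₂ (inverse (√degree#0 v))

  1/√degree-cong : ∀ v w → fromℕ (degree v) ≈ fromℕ (degree w) → 1/√degree v ≈ 1/√degree w
  1/√degree-cong v w eq = inverse-unique
    (proj₂ (inverse (√degree#0 v)))
    (trans (*-congʳ (√-cong eq)) (proj₂ (inverse (√degree#0 w))))

  -- The initial state at u is the column of N at u.
  N*𝐞 : ∀ u → N *ᵛ 𝐞 u ≈ᵛ λ a → N a u
  N*𝐞 u a = trans (∑-cong λ v → *-comm (N a v) (1ᴹ u v)) (∑-δ u (N a))

  -- The transpose of N sums over the arcs leaving a vertex, with weight
  -- 1/√degree.
  Nᵀ*ᵛ : ∀ f v → (N ᵀ *ᵛ f) v ≈ 1/√degree v * ∑ (onEdges f v)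
  Nᵀ*ᵛ f v = begin
    ∑ (λ b → N b v * f b)                                          ≈⟨ ∑-arcs (λ b → N b v * f b) ⟩
    ∑ (λ u → ∑ (onEdges (λ b → N b v * f b) u))                    ≈⟨ ∑-cong (λ u → ∑-cong (factor u)) ⟩
    ∑ (λ u → ∑ λ x → 1ᴹ v u * (1/√degree v * onEdges f u x))
      ≈⟨ ∑-cong (λ u → trans (∑-*ˡ {I = Fin n} (1ᴹ v u) _) (*-congˡ (∑-*ˡ {I = Fin n} (1/√degree v) _))) ⟩
    ∑ (λ u → 1ᴹ v u * (1/√degree v * ∑ (onEdges f u)))             ≈⟨ ∑-δ v _ ⟩
    1/√degree v * ∑ (onEdges f v)                                  ∎
    where
    factor : ∀ u x → onEdges (λ b → N b v * f b) u x ≈ 1ᴹ v u * (1/√degree v * onEdges f u x)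
    factor u x with T? (adj u x)
    ... | no _ = sym (trans (*-congˡ (zeroʳ _)) (zeroʳ _))
    ... | yes _ with u Fin.≟ v | v Fin.≟ u
    ...   | yes _      | yes _   = sym (*-identityˡ _)
    ...   | yes ≡.refl | no v≢v  = ⊥-elim (v≢v ≡.refl)
    ...   | no u≢u     | yes ≡.refl = ⊥-elim (u≢u ≡.refl)
    ...   | no _       | no _    = trans (zeroˡ _) (sym (zeroˡ _))

  N*ᵛ : ∀ x a → (N *ᵛ x) a ≈ 1/√degree (tail a) * x (tail a)
  N*ᵛ x a = trans (∑-cong factor) (∑-δ (tail a) (λ v → 1/√degree v * x v))
    where
    factor : ∀ v → N a v * x v ≈ 1ᴹ (tail a) v * (1/√degree v * x v)
    factor v with tail a Fin.≟ v
    ... | yes _ = sym (*-identityˡ _)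
    ... | no _  = trans (zeroˡ _) (sym (zeroˡ _))

  -- One step of the walk: each arc (x,y) receives twice the average of the values
  -- on the arcs leaving y, minus the value on (y,x).
  U*ᵛ : ∀ f a → (U *ᵛ f) a ≈
    fromℕ 2 * (1/√degree (head a) * 1/√degree (head a) * ∑ (onEdges f (head a))) - f (reverse a)
  U*ᵛ f a = begin
    (U *ᵛ f) a                                    ≈⟨ *ᵛ-assoc R C f a ⟩
    (R *ᵛ (C *ᵛ f)) a                             ≈⟨ ∑-δᴬ (reverse a) (C *ᵛ f) ⟩
    ∑ (λ b → C a′ b * f b)
      ≈⟨ ∑-cong (λ b → solve 4 (λ t m i f → (t :* m :+ :- i) :* f := t :* (m :* f) :+ :- con (+ 1) :* (i :* f))
           refl (fromℕ 2) ((N *ᴹ N ᵀ) a′ b) (1ᴹ a′ b) (f b)) ⟩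
    ∑ (λ b → fromℕ 2 * ((N *ᴹ N ᵀ) a′ b * f b) + - 1# * (1ᴹ a′ b * f b))
      ≈⟨ ∑-+ (λ b → fromℕ 2 * ((N *ᴹ N ᵀ) a′ b * f b)) (λ b → - 1# * (1ᴹ a′ b * f b)) ⟩
    ∑ (λ b → fromℕ 2 * ((N *ᴹ N ᵀ) a′ b * f b)) + ∑ (λ b → - 1# * (1ᴹ a′ b * f b))
      ≈⟨ +-cong (∑-*ˡ {I = Arc} (fromℕ 2) _) (∑-*ˡ {I = Arc} (- 1#) _) ⟩
    fromℕ 2 * ((N *ᴹ N ᵀ) *ᵛ f) a′ + - 1# * (1ᴹ *ᵛ f) a′
      ≈⟨ +-cong (*-congˡ NNᵀ*ᵛ) 
           (trans (*-congˡ (∑-δᴬ a′ f)) (trans (sym (-‿distribˡ-* _ _)) (-‿cong (*-identityˡ _)))) ⟩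
    fromℕ 2 * (1/√degree x * 1/√degree x * ∑ (onEdges f x)) - f a′ ∎
    where
    a′ = reverse a
    x = head a
    C : Matrix Arc Arc
    C = fromℕ 2 ·ᴹ (N *ᴹ N ᵀ) -ᴹ 1ᴹ
    NNᵀ*ᵛ : ((N *ᴹ N ᵀ) *ᵛ f) a′ ≈ 1/√degree x * 1/√degree x * ∑ (onEdges f x)
    NNᵀ*ᵛ = begin
      ((N *ᴹ N ᵀ) *ᵛ f) a′                        ≈⟨ *ᵛ-assoc N (N ᵀ) f a′ ⟩
      (N *ᵛ (N ᵀ *ᵛ f)) a′                        ≈⟨ N*ᵛ (N ᵀ *ᵛ f) a′ ⟩
      1/√degree x * (N ᵀ *ᵛ f) x                  ≈⟨ *-congˡ (Nᵀ*ᵛ f x) ⟩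
      1/√degree x * (1/√degree x * ∑ (onEdges f x)) ≈⟨ *-assoc _ _ _ ⟨
      1/√degree x * 1/√degree x * ∑ (onEdges f x) ∎

  -- The state at time t of the walk started at u.
  walk : Fin n → ℕ → Vec Arc
  walk u t = U ^ᴹ t *ᵛ (N *ᵛ 𝐞 u)

  walk-zero : ∀ u a → walk u 0 a ≈ N a u
  walk-zero u a = trans (∑-δᴬ a (N *ᵛ 𝐞 u)) (N*𝐞 u a)

  walk-suc : ∀ u t → walk u (suc t) ≈ᵛ U *ᵛ walk u t
  walk-suc u t = *ᵛ-assoc U (U ^ᴹ t) (N *ᵛ 𝐞 u)

  Bₜ≈walk : ∀ t v u → Bₜ t v u ≈ 1/√degree v * ∑ (onEdges (walk u t) v)
  Bₜ≈walk t v u = trans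
    (∑-cong {I = Arc} λ a → *-congˡ (∑-cong {I = Arc} λ b → *-congˡ (sym (N*𝐞 u b))))
    (Nᵀ*ᵛ (walk u t) v)

-- The three-state recursion behind the walk on a complete graph
module Amplitudes {c ℓ₁ ℓ₂} (ℝ : RealNumbers c ℓ₁ ℓ₂) (d : ℕ) where
  open RealNumbers ℝ
  open RealProperties ℝ
  open import Relation.Binary.Reasoning.Setoid setoid

  -- A function on the arcs of the complete graph with d + 1 vertices that is
  -- invariant under the permutations fixing a vertex u: its values on the arcs out
  -- of u, into u, and away from u.  The component total is its sum over the d arcs
  -- leaving any vertex other than u, of which one leads into u.
  record Amplitude : Set c where
    constructor amplitude
    field
      out into away : Carrier
    total : Carrier
    total = into + (fromℕ d - 1#) * away

  open Amplitude public

  module _ (h : Carrier) where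
    -- The effect of U on such a function; h stands for 1/d.
    step : Amplitude → Amplitude
    step x .out  = fromℤ (+ 2) * (h * total x) - into x
    step x .into = out x
    step x .away = fromℤ (+ 2) * (h * total x) - away x

    -- The amplitudes at time t of the walk started at u, divided by the common
    -- value 1/√d that the initial state has on the arcs out of u.
    amp : ℕ → Amplitude
    amp zero    = amplitude 1# 0# 0#
    amp (suc t) = step (amp t)

  module _ {h : Carrier} (hd≈1 : h * fromℕ d ≈ 1#) where
    -- The column sums of B_t are 1, as out is its diagonal entry and total / d its
    -- other entries.
    out+total≈1 : ∀ t → out (amp h t) + total (amp h t) ≈ 1#
    out+total≈1 zero = solve 1 (λ D →
      con (+ 1) :+ (con (+ 0) :+ (D :- con (+ 1)) :* con (+ 0)) := con (+ 1)) refl (fromℕ d)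
    out+total≈1 (suc t) = trans (linear-combination (fromℤ (+ 2) * (b + (fromℕ d - 1#) * g)) hd≈1
      (solve 5 (λ h D a b g →
         let T = con (+ 2) ; s = b :+ (D :- con (+ 1)) :* g in
         T :* (h :* s) :- b :+ (a :+ (D :- con (+ 1)) :* (T :* (h :* s) :- g)) :+ T :* s :* con (+ 1) :=
         a :+ s :+ T :* s :* (h :* D)) refl h (fromℕ d) a b g)) (out+total≈1 t)
      where
      a = out (amp h t)
      b = into (amp h t)
      g = away (amp h t)

    -- With n = d + 1, the number n B_t(u,u) - 1.  It is d T_t(-1/d), because B has
    -- the eigenvalues 1, once, and -1/d, with multiplicity d.
    cosine : ℕ → Carrier
    cosine t = fromℕ (suc d) * out (amp h t) - 1#

    cosine-0 : cosine 0 ≈ fromℕ d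
    cosine-0 = solve 1 (λ D → (con (+ 1) :+ D) :* con (+ 1) :- con (+ 1) := D) refl (fromℕ d)

    cosine-1 : cosine 1 ≈ - 1#
    cosine-1 = solve 3 (λ T h D →
      (con (+ 1) :+ D) :* (T :* (h :* (con (+ 0) :+ (D :- con (+ 1)) :* con (+ 0))) :- con (+ 0))
        :- con (+ 1) := :- con (+ 1)) refl (fromℤ (+ 2)) h (fromℕ d)

    -- By conservation total = 1 - out at the intermediate time, which eliminates
    -- the two other amplitudes from the recursion.
    cosine-suc² : ∀ t → cosine (suc (suc t)) ≈ - (fromℤ (+ 2) * h * cosine (suc t)) - cosine t
    cosine-suc² t = linear-combination (fromℤ (+ 2)) hd≈1
      (linear-combination (fromℕ (suc d) * fromℤ (+ 2) * h) (out+total≈1 (suc t))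
      (solve 5 (λ h D a a′ σ′ → let T = con (+ 2) ; i = con (+ 1) in
         (i :+ D) :* (T :* (h :* σ′) :- a) :- i :+ T :* i :+ (i :+ D) :* T :* h :* i :=
         :- (T :* h :* ((i :+ D) :* a′ :- i)) :- ((i :+ D) :* a :- i) :+ T :* (h :* D) :+
         (i :+ D) :* T :* h :* (a′ :+ σ′))
         refl h (fromℕ d) (out (amp h t)) (out (amp h (suc t))) (total (amp h (suc t)))))

    module _ (F : RescaledChebyshev d) where
      open RescaledChebyshev F using (a; b; 2b≡ad) renaming (numerator to C; denominator to p)

      2b≈ad : fromℤ (+ 2) * fromℤ (+ b) ≈ fromℤ (+ a) * fromℕ d
      2b≈ad = begin
        fromℤ (+ 2) * fromℤ (+ b) ≈⟨ fromℤ-* (+ 2) (+ b) ⟨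
        fromℤ (+ 2 ℤ.* + b)       
          ≡⟨ ≡.cong fromℤ (≡.trans (≡.sym (ℤ.pos-* 2 b)) (≡.trans (≡.cong +_ 2b≡ad) (ℤ.pos-* a d))) ⟩
        fromℤ (+ a ℤ.* + d)       ≈⟨ fromℤ-* (+ a) (+ d) ⟩
        fromℤ (+ a) * fromℤ (+ d) ≈⟨ *-congˡ (fromℕ≈fromℤ d) ⟨
        fromℤ (+ a) * fromℕ d     ∎

      p-suc : ∀ t → fromℤ (p (suc t)) ≈ fromℤ (+ b) * fromℤ (p t)
      p-suc t = trans (reflexive (≡.cong fromℤ (eq (+ b) ((+ b) ℤ.^ t)))) (fromℤ-* (+ b) (p t))
        where
        eq : ∀ b q → + 2 ℤ.* (b ℤ.* q) ≡ b ℤ.* (+ 2 ℤ.* q)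
        eq = solve-∀

      C-suc² : ∀ t → fromℤ (C (suc (suc t))) ≈
        - (fromℤ (+ a) * fromℤ (C (suc t))) - fromℤ (+ b) * fromℤ (+ b) * fromℤ (C t)
      C-suc² t = trans (fromℤ-+ (ℤ.- + a ℤ.* C (suc t)) (ℤ.- (+ b ℤ.* + b ℤ.* C t))) (+-cong
        (trans (fromℤ-* (ℤ.- + a) (C (suc t))) (trans (*-congʳ (fromℤ-neg (+ a))) (sym (-‿distribˡ-* _ _))))
        (trans (fromℤ-neg (+ b ℤ.* + b ℤ.* C t)) (-‿cong
          (trans (fromℤ-* (+ b ℤ.* + b) (C t)) (*-congʳ (fromℤ-* (+ b) (+ b)))))))

      cosine≈chebyshev : ∀ t → cosine t * fromℤ (p t) ≈ fromℕ d * fromℤ (C t)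
      cosine≈chebyshev zero = *-congʳ cosine-0
      cosine≈chebyshev (suc zero) = begin
        cosine 1 * fromℤ (p 1)           ≈⟨ *-cong cosine-1 (p-suc 0) ⟩
        - 1# * (fromℤ (+ b) * fromℤ (+ 2)) ≈⟨ linear-combination (- 1#) 2b≈ad
              (solve 4 (λ b a D T →
                 :- con (+ 1) :* (b :* T) :+ :- con (+ 1) :* (a :* D) := D :* :- a :+ :- con (+ 1) :* (T :* b))
               refl (fromℤ (+ b)) (fromℤ (+ a)) (fromℕ d) (fromℤ (+ 2))) ⟩
        fromℕ d * - fromℤ (+ a)          ≈⟨ *-congˡ (fromℤ-neg (+ a)) ⟨
        fromℕ d * fromℤ (C 1)            ∎
      cosine≈chebyshev (suc (suc t)) = begin
        cosine (suc (suc t)) * fromℤ (p (suc (suc t)))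
          ≈⟨ *-cong (cosine-suc² t) (trans (p-suc (suc t)) (*-congˡ (p-suc t))) ⟩
        (- (two * h * A′) - A) * (B * (B * P))
          ≈⟨ solve 6 (λ two h A′ A B P → (:- (two :* h :* A′) :- A) :* (B :* (B :* P)) :=
                :- (two :* B :* h :* (A′ :* (B :* P))) :- B :* B :* (A :* P)) refl two h A′ A B P ⟩
        - (two * B * h * (A′ * (B * P))) - B * B * (A * P)
          ≈⟨ +-cong (-‿cong (*-cong (*-congʳ 2b≈ad) (trans (*-congˡ (sym (p-suc t))) (cosine≈chebyshev (suc t)))))
                    (-‿cong (*-congˡ (cosine≈chebyshev t))) ⟩
        - (a′ * D * h * (D * c′)) - B * B * (D * c₀)
          ≈⟨ linear-combination (- (a′ * D * c′)) hd≈1 (solve 6 (λ a D h c′ B c₀ →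
               :- (a :* D :* h :* (D :* c′)) :- B :* B :* (D :* c₀) :+ :- (a :* D :* c′) :* con (+ 1) :=
               D :* (:- (a :* c′) :- B :* B :* c₀) :+ :- (a :* D :* c′) :* (h :* D)) refl a′ D h c′ B c₀) ⟩
        D * (- (a′ * c′) - B * B * c₀) ≈⟨ *-congˡ (C-suc² t) ⟨
        D * fromℤ (C (suc (suc t)))    ∎
        where
        two = fromℤ (+ 2)
        A = cosine t
        A′ = cosine (suc t)
        B = fromℤ (+ b)
        P = fromℤ (p t)
        D = fromℕ d
        a′ = fromℤ (+ a)
        c′ = fromℤ (C (suc t))
        c₀ = fromℤ (C t)

      -- In terms of T = T_t(-1/d), multiplied by the denominator of T: n times the
      -- off-diagonal entry of B_t is 1 - T.
      total≈chebyshev : ∀ t → fromℕ (suc d) * fromℤ (p t) * (h * total (amp h t)) ≈ fromℤ (p t) - fromℤ (C t)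
      total≈chebyshev t = linear-combination (fromℕ (suc d) * fromℤ (p t) * h) (out+total≈1 t)
        (linear-combination (- h) (cosine≈chebyshev t)
        (linear-combination (P - c₀) hd≈1
          (solve 6 (λ D P h σ α c → let i = con (+ 1) in
             (i :+ D) :* P :* (h :* σ) :+ (i :+ D) :* P :* h :* i :+ :- h :* (D :* c) :+ (P :- c) :* i :=
             P :- c :+ (i :+ D) :* P :* h :* (α :+ σ) :+ :- h :* (((i :+ D) :* α :- i) :* P) :+ (P :- c) :* (h :* D))
            refl (fromℕ d) P h (total (amp h t)) (out (amp h t)) c₀)))
        where
        P = fromℤ (p t)
        c₀ = fromℤ (C t)

-- The walk on the complete graph with d + 1 vertices
module CompleteWalk {c ℓ₁ ℓ₂} (ℝ : RealNumbers c ℓ₁ ℓ₂) (d : ℕ) (2≤n : 2 ℕ.≤ suc d) where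
  open RealNumbers ℝ
  open LinearAlgebra ℝ
  open RealProperties ℝ
  open SumProperties ℝ
  K : Graph (suc d)
  K = complete-graph (suc d) 2≤n
  open Graph K
  open Arcs K
  open ArcSums ℝ K
  open ArcReversalWalk ℝ K
  open WalkProperties ℝ K
  open Amplitudes ℝ d
  open import Relation.Binary.Reasoning.Setoid setoid

  V : Set
  V = Fin (suc d)

  adjacent : ∀ {u v : V} → u ≢ v → T (adj u v)
  adjacent {u} {v} u≢v with u Fin.≟ v
  ... | yes u≡v = u≢v u≡v
  ... | no _    = _

  tail≢head : ∀ a → tail a ≢ head a
  tail≢head (arc u v uv) ≡.refl = irreflexive {u} uv

  ∑-offDiagonal : ∀ v (f : V → Carrier) → ∑ (λ w → if adj v w then f w else 0#) ≈ ∑ f - f v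
  ∑-offDiagonal v f = begin
    ∑ (λ w → if adj v w then f w else 0#)          ≈⟨ ∑-cong term ⟩
    ∑ (λ w → f w + - 1# * (1ᴹ v w * f w))          ≈⟨ ∑-+ f (λ w → - 1# * (1ᴹ v w * f w)) ⟩
    ∑ f + ∑ (λ w → - 1# * (1ᴹ v w * f w))          ≈⟨ +-congˡ (∑-*ˡ {I = V} (- 1#) _) ⟩
    ∑ f + - 1# * ∑ (λ w → 1ᴹ v w * f w)            ≈⟨ +-congˡ (*-congˡ (∑-δ v f)) ⟩
    ∑ f + - 1# * f v                               
      ≈⟨ solve 2 (λ s x → s :+ :- con (+ 1) :* x := s :- x) refl (∑ f) (f v) ⟩
    ∑ f - f v                                      ∎
    where
    term : ∀ w → (if adj v w then f w else 0#) ≈ f w + - 1# * (1ᴹ v w * f w)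
    term w with v Fin.≟ w
    ... | yes _ = solve 1 (λ x → con (+ 0) := x :+ :- con (+ 1) :* (con (+ 1) :* x)) refl (f w)
    ... | no _  = solve 1 (λ x → x := x :+ :- con (+ 1) :* (con (+ 0) :* x)) refl (f w)

  n-1#≈d : fromℕ (suc d) * 1# - 1# ≈ fromℕ d
  n-1#≈d = solve 1 (λ D → (con (+ 1) :+ D) :* con (+ 1) :- con (+ 1) := D) refl (fromℕ d)

  fromℕ-degree≈d : ∀ v → fromℕ (degree v) ≈ fromℕ d
  fromℕ-degree≈d v = begin
    fromℕ (degree v)                       ≈⟨ fromℕ-degree v ⟩
    ∑ (λ w → if adj v w then 1# else 0#)   ≈⟨ ∑-offDiagonal v (λ _ → 1#) ⟩
    ∑ {V} (λ _ → 1#) - 1#                  ≈⟨ +-congʳ (∑-const (suc d) 1#) ⟩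
    fromℕ (suc d) * 1# - 1#                ≈⟨ n-1#≈d ⟩
    fromℕ d                                ∎

  -- All degrees are d, so s is 1/√d.
  s : Carrier
  s = 1/√degree zero

  1/√degree≈s : ∀ v → 1/√degree v ≈ s
  1/√degree≈s v = 1/√degree-cong v zero (trans (fromℕ-degree≈d v) (sym (fromℕ-degree≈d zero)))

  h : Carrier
  h = s * s

  hd≈1 : h * fromℕ d ≈ 1#
  hd≈1 = trans (*-congˡ (sym (fromℕ-degree≈d zero))) (1/√degree² zero)

  1#0 : ¬ (1# ≈ 0#)
  1#0 1≈0 = <-irrefl (sym 1≈0) 0<1

  -- The value, at the pair (v,w), of the function with amplitudes x relative to u.
  profile : V → Amplitude → V → V → Carrier
  profile u x v w = if does (v Fin.≟ u) then out x else if does (w Fin.≟ u) then into x else away x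

  onArcs : V → Amplitude → Vec Arc
  onArcs u x a = s * profile u x (tail a) (head a)

  if-T : ∀ b {x : Carrier} → T b → (if b then x else 0#) ≈ x
  if-T true _ = refl

  if-¬T : ∀ b {x : Carrier} → ¬ T b → (if b then x else 0#) ≈ 0#
  if-¬T true ¬b  = ⊥-elim (¬b _)
  if-¬T false ¬b = refl

  ∑-onEdges : ∀ f v (g : V → Carrier) → (∀ w (vw : T (adj v w)) → f (arc v w vw) ≈ g w) →
    ∑ (onEdges f v) ≈ ∑ g - g v
  ∑-onEdges f v g f≈g = trans (∑-cong term) (∑-offDiagonal v g)
    where
    term : ∀ w → onEdges f v w ≈ (if adj v w then g w else 0#)
    term w with T? (adj v w)
    ... | yes vw = trans (f≈g w vw) (sym (if-T (adj v w) vw))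
    ... | no ¬vw = sym (if-¬T (adj v w) ¬vw)

  profile-out : ∀ u x w → profile u x u w ≈ out x
  profile-out u x w with u Fin.≟ u
  ... | yes _  = refl
  ... | no u≢u = ⊥-elim (u≢u ≡.refl)

  profile-into : ∀ {u v} x → v ≢ u → profile u x v u ≈ into x
  profile-into {u} {v} x v≢u with v Fin.≟ u | u Fin.≟ u
  ... | yes v≡u | _      = ⊥-elim (v≢u v≡u)
  ... | no _    | yes _  = refl
  ... | no _    | no u≢u = ⊥-elim (u≢u ≡.refl)

  profile-away : ∀ {u v w} x → v ≢ u → w ≢ u → profile u x v w ≈ away x
  profile-away {u} {v} {w} x v≢u w≢u with v Fin.≟ u | w Fin.≟ u
  ... | yes v≡u | _       = ⊥-elim (v≢u v≡u)
  ... | no _    | yes w≡u = ⊥-elim (w≢u w≡u)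
  ... | no _    | no _    = refl

  module _ (u : V) (x : Amplitude) where
    ∑-source : ∑ (onEdges (onArcs u x) u) ≈ s * (fromℕ d * out x)
    ∑-source = begin
      ∑ (onEdges (onArcs u x) u)            ≈⟨ ∑-onEdges _ u (λ _ → s * out x) (λ w uw → *-congˡ (profile-out u x w)) ⟩
      ∑ {V} (λ _ → s * out x) - s * out x   ≈⟨ +-congʳ (∑-const (suc d) (s * out x)) ⟩
      fromℕ (suc d) * (s * out x) - s * out x
        ≈⟨ solve 3 (λ D s a → (con (+ 1) :+ D) :* (s :* a) :- s :* a := s :* (D :* a)) refl (fromℕ d) s (out x) ⟩
      s * (fromℕ d * out x)                 ∎

    -- Among the d arcs leaving v, one leads to u and d - 1 are away from u.  The
    -- summand g has to be corrected at w = v, where there is no arc.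
    ∑-other : ∀ {v} → v ≢ u → ∑ (onEdges (onArcs u x) v) ≈ s * total x
    ∑-other {v} v≢u = begin
      ∑ (onEdges (onArcs u x) v)            ≈⟨ ∑-onEdges _ v g (λ w vw → term w) ⟩
      ∑ g - g v                             ≈⟨ +-congˡ (-‿cong gv) ⟩
      ∑ g - s * away x
        ≈⟨ +-congʳ (trans (∑-+ {I = V} (λ _ → s * away x) _) (+-cong (∑-const (suc d) _) (∑-δ u _))) ⟩
      fromℕ (suc d) * (s * away x) + s * (into x - away x) - s * away x
        ≈⟨ solve 4 (λ D s b g → (con (+ 1) :+ D) :* (s :* g) :+ s :* (b :- g) :- s :* g :=
                                s :* (b :+ (D :- con (+ 1)) :* g)) refl (fromℕ d) s (into x) (away x) ⟩
      s * total x                           ∎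
      where
      g : V → Carrier
      g w = s * away x + 1ᴹ u w * (s * (into x - away x))
      gv : g v ≈ s * away x
      gv with u Fin.≟ v
      ... | yes ≡.refl = ⊥-elim (v≢u ≡.refl)
      ... | no _       = trans (+-congˡ (zeroˡ _)) (+-identityʳ _)
      term : ∀ w → s * profile u x v w ≈ g w
      term w with u Fin.≟ w
      ... | yes ≡.refl = trans (*-congˡ (profile-into x v≢u))
        (solve 3 (λ s b g → s :* b := s :* g :+ con (+ 1) :* (s :* (b :- g))) refl s (into x) (away x))
      ... | no u≢w = trans (*-congˡ (profile-away x v≢u (u≢w ∘ ≡.sym)))
        (sym (trans (+-congˡ (zeroˡ _)) (+-identityʳ _)))

    -- The space of functions invariant under the stabiliser of u is preserved by U,
    -- which acts on it by step.
    U-onArcs : U *ᵛ onArcs u x ≈ᵛ onArcs u (step h x)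
    U-onArcs a = trans (U*ᵛ (onArcs u x) a) (trans
      (+-congʳ (*-cong (fromℕ≈fromℤ 2) (*-congʳ (*-cong (1/√degree≈s (head a)) (1/√degree≈s (head a))))))
      (by-cases (tail a) (head a) (tail≢head a) (tail a Fin.≟ u) (head a Fin.≟ u)))
      where
      reflected : ∀ y → fromℤ (+ 2) * (h * (s * total x)) - s * y ≈ s * (fromℤ (+ 2) * (h * total x) - y)
      reflected y = solve 4 (λ h s t b →
        con (+ 2) :* (h :* (s :* t)) :- s :* b := s :* (con (+ 2) :* (h :* t) :- b)) refl h s (total x) y

      by-cases : ∀ v w → v ≢ w → Dec (v ≡ u) → Dec (w ≡ u) →
        fromℤ (+ 2) * (h * ∑ (onEdges (onArcs u x) w)) - s * profile u x w v ≈
        s * profile u (step h x) v w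
      by-cases v w v≢w (yes ≡.refl) _ = trans
        (+-cong (*-congˡ (*-congˡ (∑-other w≢u))) (-‿cong (*-congˡ (profile-into x w≢u))))
        (trans (reflected (into x)) (*-congˡ (sym (profile-out u (step h x) w))))
        where
        w≢u : w ≢ u
        w≢u = v≢w ∘ ≡.sym
      by-cases v w v≢w (no v≢u) (yes ≡.refl) = trans
        (+-cong (*-congˡ (*-congˡ ∑-source)) (-‿cong (*-congˡ (profile-out u x v))))
        (trans
          (linear-combination (fromℤ (+ 2) * s * out x) hd≈1
            (solve 4 (λ h s D a →
               con (+ 2) :* (h :* (s :* (D :* a))) :- s :* a :+ con (+ 2) :* s :* a :* con (+ 1) :=
               s :* a :+ con (+ 2) :* s :* a :* (h :* D)) refl h s (fromℕ d) (out x)))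
          (*-congˡ (sym (profile-into (step h x) v≢u))))
      by-cases v w v≢w (no v≢u) (no w≢u) = trans
        (+-cong (*-congˡ (*-congˡ (∑-other w≢u))) (-‿cong (*-congˡ (profile-away x w≢u v≢u))))
        (trans (reflected (away x)) (*-congˡ (sym (profile-away (step h x) v≢u w≢u))))

  onEdges-cong : ∀ {f g : Vec Arc} → f ≈ᵛ g → ∀ v w → onEdges f v w ≈ onEdges g v w
  onEdges-cong f≈g v w with T? (adj v w)
  ... | yes vw = f≈g (arc v w vw)
  ... | no _   = refl

  walk≈onArcs : ∀ u t → walk u t ≈ᵛ onArcs u (amp h t)
  walk≈onArcs u zero a = trans (walk-zero u a) (initial (tail a) (head a))
    where
    initial : ∀ v w → (if does (v Fin.≟ u) then 1/√degree u else 0#) ≈ s * profile u (amp h 0) v w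
    initial v w with v Fin.≟ u | w Fin.≟ u
    ... | yes _ | _     = trans (1/√degree≈s u) (sym (*-identityʳ s))
    ... | no _  | yes _ = sym (zeroʳ s)
    ... | no _  | no _  = sym (zeroʳ s)
  walk≈onArcs u (suc t) a = begin
    walk u (suc t) a               ≈⟨ walk-suc u t a ⟩
    (U *ᵛ walk u t) a              ≈⟨ *ᵛ-cong U (walk≈onArcs u t) a ⟩
    (U *ᵛ onArcs u (amp h t)) a    ≈⟨ U-onArcs u (amp h t) a ⟩
    onArcs u (amp h (suc t)) a     ∎

  Bₜ-diagonal : ∀ t u → Bₜ t u u ≈ out (amp h t)
  Bₜ-diagonal t u = begin
    Bₜ t u u                                              ≈⟨ Bₜ≈walk t u u ⟩
    1/√degree u * ∑ (onEdges (walk u t) u)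
      ≈⟨ *-cong (1/√degree≈s u) (trans (∑-cong (onEdges-cong (walk≈onArcs u t) u)) (∑-source u (amp h t))) ⟩
    s * (s * (fromℕ d * out (amp h t)))
      ≈⟨ linear-combination (out (amp h t)) hd≈1 (solve 3 (λ s D a →
           s :* (s :* (D :* a)) :+ a :* con (+ 1) := a :+ a :* (s :* s :* D)) refl s (fromℕ d) (out (amp h t))) ⟩
    out (amp h t)                                         ∎

  Bₜ-offDiagonal : ∀ t {v u} → v ≢ u → Bₜ t v u ≈ h * total (amp h t)
  Bₜ-offDiagonal t {v} {u} v≢u = begin
    Bₜ t v u                                              ≈⟨ Bₜ≈walk t v u ⟩
    1/√degree v * ∑ (onEdges (walk u t) v)
      ≈⟨ *-cong (1/√degree≈s v) (trans (∑-cong (onEdges-cong (walk≈onArcs u t) v)) (∑-other u (amp h t) v≢u)) ⟩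
    s * (s * total (amp h t))                             ≈⟨ *-assoc s s _ ⟨
    h * total (amp h t)                                   ∎

-- The spectrum of B and peak state transfer on complete graphs
module Spectrum {c ℓ₁ ℓ₂} (ℝ : RealNumbers c ℓ₁ ℓ₂) (d : ℕ) (2≤n : 2 ℕ.≤ suc d) where
  open RealNumbers ℝ
  open LinearAlgebra ℝ
  open RealProperties ℝ
  open SumProperties ℝ
  open CompleteWalk ℝ d 2≤n
  open Graph K
  open Arcs K
  open ArcSums ℝ K
  open ArcReversalWalk ℝ K
  open WalkProperties ℝ K
  open Amplitudes ℝ d
  open import Relation.Binary.Reasoning.Setoid setoid

  out₁≈0 : out (amp h 1) ≈ 0#
  out₁≈0 = solve 2 (λ h D → con (+ 2) :* (h :* (con (+ 0) :+ (D :- con (+ 1)) :* con (+ 0))) :- con (+ 0) :=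
                            con (+ 0)) refl h (fromℕ d)

  total₁≈1 : total (amp h 1) ≈ 1#
  total₁≈1 = trans (sym (+-identityˡ _)) (trans (+-congʳ (sym out₁≈0)) (out+total≈1 hd≈1 1))

  away₁≈0 : away (amp h 1) ≈ 0#
  away₁≈0 = out₁≈0

  -- The matrix B is h (J - I), where J is the all-ones matrix.
  B*ᵛ : ∀ x v → (B *ᵛ x) v ≈ h * (∑ x - x v)
  B*ᵛ x v = begin
    ∑ (λ w → B v w * x w)                           ≈⟨ ∑-cong term ⟩
    ∑ (λ w → h * (if adj v w then x w else 0#))     ≈⟨ ∑-*ˡ {I = V} h _ ⟩
    h * ∑ (λ w → if adj v w then x w else 0#)       ≈⟨ *-congˡ (∑-offDiagonal v x) ⟩
    h * (∑ x - x v)                                 ∎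
    where
    term : ∀ w → B v w * x w ≈ h * (if adj v w then x w else 0#)
    term w = by-cases (v Fin.≟ w)
      where
      by-cases : Dec (v ≡ w) → B v w * x w ≈ h * (if adj v w then x w else 0#)
      by-cases (yes ≡.refl) = trans
        (trans (*-congʳ (trans (Bₜ-diagonal 1 v) out₁≈0)) (zeroˡ _))
        (sym (trans (*-congˡ (if-¬T (adj v v) (irreflexive {v}))) (zeroʳ h)))
      by-cases (no v≢w) = *-cong
        (trans (Bₜ-offDiagonal 1 v≢w) (trans (*-congˡ total₁≈1) (*-identityʳ h)))
        (sym (if-T (adj v w) (adjacent v≢w)))

  constant-eigenvector : B *ᵛ (λ _ → 1#) ≈ᵛ 1# ·ᵛ (λ _ → 1#)
  constant-eigenvector v = begin
    (B *ᵛ (λ _ → 1#)) v             ≈⟨ B*ᵛ (λ _ → 1#) v ⟩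
    h * (∑ {V} (λ _ → 1#) - 1#)     ≈⟨ *-congˡ (trans (+-congʳ (∑-const (suc d) 1#)) n-1#≈d) ⟩
    h * fromℕ d                     ≈⟨ hd≈1 ⟩
    1#                              ≈⟨ *-identityˡ 1# ⟨
    1# * 1#                         ∎

  sumZero-eigenvector : ∀ x → ∑ x ≈ 0# → B *ᵛ x ≈ᵛ (- h) ·ᵛ x
  sumZero-eigenvector x ∑x≈0 v = trans (B*ᵛ x v) (trans (*-congˡ (+-congʳ ∑x≈0))
    (solve 2 (λ h x → h :* (con (+ 0) :- x) := (:- h) :* x) refl h (x v)))

  ∑-𝐞 : ∀ (v : V) → ∑ (𝐞 v) ≈ 1#
  ∑-𝐞 v = trans (∑-cong λ w → sym (*-identityʳ (𝐞 v w))) (∑-δ v (λ _ → 1#))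

  -- The vector n e_v - 1, a multiple of the projection of e_v to the vectors with
  -- sum zero.
  centred : V → Vec V
  centred v w = fromℕ (suc d) * 1ᴹ v w + - 1# * 1#

  ∑-centred : ∀ v → ∑ (centred v) ≈ 0#
  ∑-centred v = begin
    ∑ (centred v)
      ≈⟨ ∑-+ {I = V} _ _ ⟩
    ∑ (λ w → fromℕ (suc d) * 1ᴹ v w) + ∑ {V} (λ _ → - 1# * 1#)
      ≈⟨ +-cong (trans (∑-*ˡ {I = V} (fromℕ (suc d)) _) (*-congˡ (∑-𝐞 v))) (∑-const (suc d) (- 1# * 1#)) ⟩
    fromℕ (suc d) * 1# + fromℕ (suc d) * (- 1# * 1#)
      ≈⟨ solve 1 (λ n → n :* con (+ 1) :+ n :* (:- con (+ 1) :* con (+ 1)) := con (+ 0)) refl (fromℕ (suc d)) ⟩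
    0# ∎

  centred-self : ∀ v → centred v v ≈ fromℕ d
  centred-self v with v Fin.≟ v
  ... | yes _  = solve 1 (λ D → (con (+ 1) :+ D) :* con (+ 1) :+ :- con (+ 1) :* con (+ 1) := D) refl (fromℕ d)
  ... | no v≢v = ⊥-elim (v≢v ≡.refl)

  centred-other : ∀ {u v} → u ≢ v → centred v u ≈ - 1#
  centred-other {u} {v} u≢v with v Fin.≟ u
  ... | yes v≡u = ⊥-elim (u≢v (≡.sym v≡u))
  ... | no _    = solve 1 (λ n → n :* con (+ 0) :+ :- con (+ 1) :* con (+ 1) := :- con (+ 1)) refl (fromℕ (suc d))

  module _ {θ} {E : Matrix V V} (P : IsEigenprojection B θ E) where
    open IsEigenprojection P renaming (symmetric to E-symmetric)

    E*𝐞 : ∀ v → E *ᵛ 𝐞 v ≈ᵛ λ u → E u v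
    E*𝐞 v u = trans (∑-cong λ w → *-comm (E u w) (𝐞 v w)) (∑-δ v (E u))

    columnSum : ∀ v → ∑ (E *ᵛ 𝐞 v) ≈ ∑ (E v)
    columnSum v = trans (∑-cong (E*𝐞 v)) (∑-cong λ u → E-symmetric v u)

    -- The columns of an eigenprojection are in the eigenspace, and their sums are
    -- the row sums by symmetry.
    column-eigenvector : ∀ u v → h * (∑ (E v) - E u v) ≈ θ * E u v
    column-eigenvector u v = begin
      h * (∑ (E v) - E u v)
        ≈⟨ *-congˡ (+-cong (columnSum v) (-‿cong (E*𝐞 v u))) ⟨
      h * (∑ (E *ᵛ 𝐞 v) - (E *ᵛ 𝐞 v) u)  ≈⟨ B*ᵛ (E *ᵛ 𝐞 v) u ⟨
      (B *ᵛ (E *ᵛ 𝐞 v)) u               ≈⟨ range⊆ (𝐞 v) u ⟩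
      θ * (E *ᵛ 𝐞 v) u                  ≈⟨ *-congˡ (E*𝐞 v u) ⟩
      θ * E u v                         ∎

    -- The projection to the eigenvalue 1 is J/n: its columns are constant, and its
    -- row sums are 1 because it fixes the constant vector.
    constant-projection : 1# ≈ θ → ∀ u v → fromℕ (suc d) * E u v ≈ 1#
    constant-projection 1≈θ u v = trans (sym rowSum) (begin
      ∑ (E v)                           ≈⟨ ∑-cong (λ w → *-identityʳ (E v w)) ⟨
      (E *ᵛ (λ _ → 1#)) v               ≈⟨ range⊇ (λ _ → 1#) (λ w → trans (constant-eigenvector w) (*-congʳ 1≈θ)) v ⟩
      1#                                ∎)
      where
      rowSum : ∑ (E v) ≈ fromℕ (suc d) * E u v
      rowSum = linear-combination (fromℕ d) (trans (column-eigenvector u v) (*-congʳ (sym 1≈θ)))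
        (linear-combination (- (∑ (E v) - E u v)) hd≈1
          (solve 4 (λ D h S e → let i = con (+ 1) in
             S :+ D :* (i :* e) :+ (:- (S :- e)) :* i :=
             (i :+ D) :* e :+ D :* (h :* (S :- e)) :+ (:- (S :- e)) :* (h :* D)) refl (fromℕ d) h (∑ (E v)) (E u v)))

    -- The projection to the eigenvalue -h is I - J/n: its row sums vanish and it
    -- fixes n e_v - 1.
    sumZero-projection : - h ≈ θ → ∀ {u v} → u ≢ v → fromℕ (suc d) * E u v ≈ - 1#
    sumZero-projection -h≈θ {u} {v} u≢v = begin
      fromℕ (suc d) * E u v
        ≈⟨ solve 2 (λ n e → n :* e := n :* e :+ :- con (+ 1) :* con (+ 0)) refl (fromℕ (suc d)) (E u v) ⟩
      fromℕ (suc d) * E u v + - 1# * 0#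
        ≈⟨ +-cong (*-congˡ (E*𝐞 v u)) (*-congˡ rowSum) ⟨
      fromℕ (suc d) * (E *ᵛ 𝐞 v) u + - 1# * ∑ (E u)
        ≈⟨ trans (∑-+ {I = V} _ _) (+-cong (∑-*ˡ {I = V} (fromℕ (suc d)) _) (∑-*ˡ {I = V} (- 1#) _)) ⟨
      ∑ (λ w → fromℕ (suc d) * (E u w * 1ᴹ v w) + - 1# * E u w)
        ≈⟨ ∑-cong (λ w → solve 3 (λ n e δ → n :* (e :* δ) :+ :- con (+ 1) :* e :=
             e :* (n :* δ :+ :- con (+ 1) :* con (+ 1))) refl (fromℕ (suc d)) (E u w) (1ᴹ v w)) ⟩
      (E *ᵛ centred v) u
        ≈⟨ range⊇ (centred v) (λ w → trans (sumZero-eigenvector (centred v) (∑-centred v) w) (*-congʳ -h≈θ)) u ⟩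
      centred v u
        ≈⟨ centred-other u≢v ⟩
      - 1# ∎
      where
      rowSum : ∑ (E u) ≈ 0#
      rowSum = linear-combination (fromℕ d) (trans (column-eigenvector u u) (*-congʳ (sym -h≈θ)))
        (linear-combination (- ∑ (E u)) hd≈1
          (solve 4 (λ D h S e →
             S :+ D :* ((:- h) :* e) :+ (:- S) :* con (+ 1) :=
             con (+ 0) :+ D :* (h :* (S :- e)) :+ (:- S) :* (h :* D)) refl (fromℕ d) h (∑ (E u)) (E u u)))

  1≢-h : ¬ (1# ≈ - h)
  1≢-h 1≈-h = <-irrefl (sym n≈0) (0<fromℕ-suc d)
    where
    n≈0 : fromℕ (suc d) ≈ 0#
    n≈0 = linear-combination (fromℕ d) 1≈-h (linear-combination (- 1#) hd≈1
      (solve 2 (λ D h → let i = con (+ 1) in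
         i :+ D :+ D :* :- h :+ :- i :* i := con (+ 0) :+ D :* i :+ :- i :* (h :* D)) refl (fromℕ d) h))

  module _ (S : SpectralDecomposition B) where
    open SpectralDecomposition S

    -- The sum of all |E(u,v)| is at least 2/n.  The two eigenvalues 1 and -h, which
    -- occur in every spectral decomposition, already contribute this much.
    spectralMass : ∀ {u v} → u ≢ v →
      ∃[ e ] fromℕ (suc d) * e ≈ fromℤ (+ 2) × e ≤ ∑ (λ r → abs (E r u v))
    spectralMass {u} {v} u≢v =
      E r₁ u v - E r₂ u v
      , trans (solve 3 (λ n x y → n :* (x :- y) := n :* x :- n :* y) refl (fromℕ (suc d)) (E r₁ u v) (E r₂ u v))
          (trans (+-cong (constant-projection (projection r₁) 1≈θ u v)
                         (-‿cong (sumZero-projection (projection r₂) -h≈θ u≢v)))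
            (+-congˡ (-‿involutive 1#)))
      , ≤-trans (+-mono-≤ (x≤x∨y (E r₁ u v) (- E r₁ u v)) (y≤x∨y (E r₂ u v) (- E r₂ u v)))
          (twoTerms≤∑ {f = λ r → abs (E r u v)} (λ r → abs-nonneg (E r u v)) r₁≢r₂)
      where
      1∈spectrum : ∃[ r ] 1# ≈ θ r
      1∈spectrum = exhaustive ((λ _ → 1#) , constant-eigenvector , λ 1≈0 → 1#0 (1≈0 zero))
      -h∈spectrum : ∃[ r ] - h ≈ θ r
      -h∈spectrum = exhaustive (centred v , sumZero-eigenvector (centred v) (∑-centred v) , λ x≈0 →
        <-irrefl (trans (sym (x≈0 v)) (centred-self v))
          (<-respʳ-≈ (fromℕ-degree≈d v) (0<fromℕ (degree v) {{degree-nonZero v}})))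
      r₁ = proj₁ 1∈spectrum
      r₂ = proj₁ -h∈spectrum
      1≈θ : 1# ≈ θ r₁
      1≈θ = proj₂ 1∈spectrum
      -h≈θ : - h ≈ θ r₂
      -h≈θ = proj₂ -h∈spectrum
      r₁≢r₂ : r₁ ≢ r₂
      r₁≢r₂ r₁≡r₂ = 1≢-h (trans 1≈θ (trans (reflexive (≡.cong θ r₁≡r₂)) (sym -h≈θ)))

  -- With T = T_t(-1/d), peak state transfer needs 1 - T = n |B_t(u,v)| ≥ 2,
  -- whereas -1 < T ≤ 1.  The inequality is compared after multiplication by n and
  -- the denominator of T.
  noPeakStateTransfer : 2 ℕ.≤ d → ¬ (∃[ u ] ∃[ v ] ∃[ t ] PeakStateTransfer u v t)
  noPeakStateTransfer 2≤d (u , v , t , u≢v , 1≤t , S , |β|≈∑ , _) =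
    Me≰Mβ (*-monoʳ-≤ M 0<M (≤-trans e≤∑ (≤-trans (≤-reflexive (sym |β|≈∑)) (0≤x⇒abs≤x 0≤β))))
    where
    mass = spectralMass S u≢v
    e = proj₁ mass
    ne≈2 = proj₁ (proj₂ mass)
    e≤∑ = proj₂ (proj₂ mass)
    open RescaledChebyshev (rescaledChebyshev d 2≤d) renaming (numerator to C; denominator to p)
    β M : Carrier
    β = Bₜ t u v
    M = fromℕ (suc d) * fromℤ (p t)
    0<M : 0# < M
    0<M = *-positive (0<fromℕ-suc d) (fromℤ-mono-< (0<denominator t))
    Mβ≈ : M * β ≈ fromℤ (p t) - fromℤ (C t)
    Mβ≈ = trans (*-congˡ (Bₜ-offDiagonal t u≢v)) (total≈chebyshev hd≈1 (rescaledChebyshev d 2≤d) t)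
    0≤β : 0# ≤ β
    0≤β β<0 = fromℤ-mono-≤ (numerator≤denominator t) (0<y-x⇒x<y (<-respˡ-≈ refl (<-respʳ-≈
      (trans (-‿cong Mβ≈) (solve 2 (λ p c → :- (p :- c) := c :- p) refl (fromℤ (p t)) (fromℤ (C t))))
      (<-respʳ-≈ (+-identityˡ _) (x<y⇒0<y-x (<-respʳ-≈ (zeroʳ M) (*-monoʳ-< M 0<M β<0)))))))
    Me≰Mβ : ¬ (M * e ≤ M * β)
    Me≰Mβ Me≤Mβ = Me≤Mβ (0<y-x⇒x<y (<-respʳ-≈ eq (x<y⇒0<y-x (fromℤ-mono-< -p<c))))
      where
      -p<c : ℤ.- p t ℤ.< C t
      -p<c = ℤ.≤∧≢⇒< (-denominator≤numerator t) (numerator≢-denominator t 1≤t ∘ ≡.sym)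
      eq : fromℤ (C t) - fromℤ (ℤ.- p t) ≈ M * e - M * β
      eq = begin
        fromℤ (C t) - fromℤ (ℤ.- p t)  ≈⟨ +-congˡ (-‿cong (fromℤ-neg (p t))) ⟩
        fromℤ (C t) - - fromℤ (p t)
          ≈⟨ solve 2 (λ c p → c :- :- p := p :* con (+ 2) :- (p :- c)) refl (fromℤ (C t)) (fromℤ (p t)) ⟩
        fromℤ (p t) * fromℤ (+ 2) - (fromℤ (p t) - fromℤ (C t))
          ≈⟨ +-cong (*-congˡ ne≈2) (-‿cong Mβ≈) ⟨
        fromℤ (p t) * (fromℕ (suc d) * e) - M * β
          ≈⟨ +-congʳ (solve 3 (λ n p e → p :* (n :* e) := n :* p :* e) refl (fromℕ (suc d)) (fromℤ (p t)) e) ⟩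
        M * e - M * β                  ∎

-- Periodicity on complete graphs
module Transfer {c ℓ₁ ℓ₂} (ℝ : RealNumbers c ℓ₁ ℓ₂) (d : ℕ) (2≤n : 2 ℕ.≤ suc d) where
  open RealNumbers ℝ
  open LinearAlgebra ℝ
  open Complex ℝ
  open RealProperties ℝ
  open SumProperties ℝ
  open CompleteWalk ℝ d 2≤n
  open Spectrum ℝ d 2≤n
  open Graph K
  open Arcs K
  open ArcReversalWalk ℝ K
  open WalkProperties ℝ K
  open Amplitudes ℝ d
  open import Relation.Binary.Reasoning.Setoid setoid

  N-source : ∀ {a v} → tail a ≡ v → N a v ≈ s
  N-source {a} {v} ta≡v with tail a Fin.≟ v
  ... | yes _   = 1/√degree≈s v
  ... | no ta≢v = ⊥-elim (ta≢v ta≡v)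

  N-other : ∀ {a v} → tail a ≢ v → N a v ≈ 0#
  N-other {a} {v} ta≢v with tail a Fin.≟ v
  ... | yes ta≡v = ⊥-elim (ta≢v ta≡v)
  ... | no _     = refl

  s-cancel : ∀ {x} → s * x ≈ 0# → x ≈ 0#
  s-cancel {x} sx≈0 = linear-combination (- x) hd≈1 (linear-combination (s * fromℕ d) sx≈0
    (solve 3 (λ s D x → x :+ :- x :* con (+ 1) :+ s :* D :* con (+ 0) :=
                        con (+ 0) :+ :- x :* (s :* s :* D) :+ s :* D :* (s :* x)) refl s (fromℕ d) x))

  -- A transfer of states with phase 1.
  walk⇒Transfers : ∀ u v t → (∀ a → walk u t a ≈ N a v) → Transfers u v t
  walk⇒Transfers u v t walk≈N = 1# +i 0# , modulus≈1 , λ a →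
    ( (begin
        walk u t a                               ≈⟨ walk≈N a ⟩
        N a v                                    ≈⟨ N*𝐞 v a ⟨
        (N *ᵛ 𝐞 v) a
          ≈⟨ solve 1 (λ x → x := con (+ 1) :* x :- con (+ 0) :* con (+ 0)) refl ((N *ᵛ 𝐞 v) a) ⟩
        1# * (N *ᵛ 𝐞 v) a - 0# * 0#             ∎)
    , solve 1 (λ x → con (+ 0) := con (+ 1) :* con (+ 0) :+ con (+ 0) :* x) refl ((N *ᵛ 𝐞 v) a))
    where
    modulus≈1 : √ (1# * 1# + 0# * 0#) ≈ 1#
    modulus≈1 = trans (√-cong (solve 0 (con (+ 1) :* con (+ 1) :+ con (+ 0) :* con (+ 0) := con (+ 1)) refl)) √1≈1

  -- The final state of a transfer to v is supported on the arcs leaving v.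
  Transfers⇒profile≈0 : ∀ u v t → Transfers u v t →
    ∀ {x y} → x ≢ v → x ≢ y → profile u (amp h t) x y ≈ 0#
  Transfers⇒profile≈0 u v t (γ , _ , eq) {x} {y} x≢v x≢y = s-cancel (begin
    s * profile u (amp h t) x y                 ≈⟨ walk≈onArcs u t a ⟨
    walk u t a                                  ≈⟨ proj₁ (eq a) ⟩
    re γ * (N *ᵛ 𝐞 v) a - im γ * 0#            ≈⟨ +-congʳ (*-congˡ (trans (N*𝐞 v a) (N-other {a} x≢v))) ⟩
    re γ * 0# - im γ * 0#
      ≈⟨ solve 2 (λ r i → r :* con (+ 0) :- i :* con (+ 0) := con (+ 0)) refl (re γ) (im γ) ⟩
    0#                                          ∎)
    where
    a : Arc
    a = arc x y (adjacent x≢y)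

  otherVertex : ∀ {d} → 2 ℕ.≤ suc d → (u : Fin (suc d)) → ∃[ w ] w ≢ u
  otherVertex (s≤s (s≤s _)) u = punchIn u zero , Fin.punchInᵢ≢i u zero

  twoOtherVertices : ∀ {d} → 2 ℕ.≤ d → (u : Fin (suc d)) → ∃[ w ] ∃[ w′ ] w ≢ u × w′ ≢ u × w ≢ w′
  twoOtherVertices (s≤s (s≤s _)) u = punchIn u zero , punchIn u (suc zero)
    , Fin.punchInᵢ≢i u zero , Fin.punchInᵢ≢i u (suc zero)
    , λ eq → case Fin.punchIn-injective u zero (suc zero) eq of λ ()

  Transfers⇒into≈0 : ∀ u t → Transfers u u t → into (amp h t) ≈ 0#
  Transfers⇒into≈0 u t tr =
    trans (sym (profile-into (amp h t) w≢u)) (Transfers⇒profile≈0 u u t tr w≢u w≢u)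
    where
    w≢u : proj₁ (otherVertex 2≤n u) ≢ u
    w≢u = proj₂ (otherVertex 2≤n u)

  Transfers⇒away≈0 : 2 ℕ.≤ d → ∀ u t → Transfers u u t → away (amp h t) ≈ 0#
  Transfers⇒away≈0 2≤d u t tr = by-witnesses (twoOtherVertices 2≤d u)
    where
    by-witnesses : (∃[ w ] ∃[ w′ ] w ≢ u × w′ ≢ u × w ≢ w′) → away (amp h t) ≈ 0#
    by-witnesses (w , w′ , w≢u , w′≢u , w≢w′) =
      trans (sym (profile-away (amp h t) w≢u w′≢u)) (Transfers⇒profile≈0 u u t tr w≢u w≢w′)

  -- At a return to u the amplitudes into and away vanish, hence so does total, and
  -- T_t(-1/d) = 1.  With at least three vertices both kinds of arcs exist.
  notPeriodic : 3 ℕ.≤ d → ¬ (∃[ u ] Periodic u)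
  notPeriodic 3≤d (u , t , 1≤t , tr) = numerator≢denominator 3≤d t 1≤t (fromℤ-injective C≈P)
    where
    2≤d : 2 ℕ.≤ d
    2≤d = ℕ.≤-trans (ℕ.n≤1+n 2) 3≤d
    open RescaledChebyshev (rescaledChebyshev d 2≤d) renaming (numerator to C; denominator to p)
    total≈0 : total (amp h t) ≈ 0#
    total≈0 = trans (+-cong (Transfers⇒into≈0 u t tr) (*-congˡ (Transfers⇒away≈0 2≤d u t tr)))
      (trans (+-identityˡ _) (zeroʳ _))
    C≈P : fromℤ (C t) ≈ fromℤ (p t)
    C≈P = linear-combination 1# (total≈chebyshev hd≈1 (rescaledChebyshev d 2≤d) t)
      (linear-combination (- (fromℕ (suc d) * fromℤ (p t) * h)) total≈0
        (solve 5 (λ n p h t c →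
           c :+ con (+ 1) :* (p :- c) :+ :- (n :* p :* h) :* con (+ 0) :=
           p :+ con (+ 1) :* (n :* p :* (h :* t)) :+ :- (n :* p :* h) :* t) refl
           (fromℕ (suc d)) (fromℤ (p t)) h (total (amp h t)) (fromℤ (C t))))

  -- The initial amplitude on the arcs out of u moves to the arcs into u.
  notPeriod1 : ∀ u → ¬ Transfers u u 1
  notPeriod1 u tr = 1#0 (Transfers⇒into≈0 u 1 tr)

  out₂≈ : out (amp h 2) ≈ fromℤ (+ 2) * h - 1#
  out₂≈ = +-congʳ (*-congˡ (trans (*-congˡ total₁≈1) (*-identityʳ h)))

  away₂≈ : away (amp h 2) ≈ fromℤ (+ 2) * h
  away₂≈ = trans (+-cong (*-congˡ (trans (*-congˡ total₁≈1) (*-identityʳ h))) (-‿cong away₁≈0))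
    (trans (+-congˡ -0#≈0#) (+-identityʳ _))

  -- The amplitude away from u is 2/d at time 2.
  notPeriod2 : 2 ℕ.≤ d → ∀ u → ¬ Transfers u u 2
  notPeriod2 2≤d u tr = case fromℤ-injective {+ 2} {+ 0} 2≈0 of λ ()
    where
    2≈0 : fromℤ (+ 2) ≈ 0#
    2≈0 = linear-combination (fromℕ d) (trans (sym away₂≈) (Transfers⇒away≈0 2≤d u 2 tr))
      (linear-combination (- fromℤ (+ 2)) hd≈1 (solve 2 (λ h D →
        con (+ 2) :+ D :* con (+ 0) :+ :- con (+ 2) :* con (+ 1) :=
        con (+ 0) :+ D :* (con (+ 2) :* h) :+ :- con (+ 2) :* (h :* D)) refl h (fromℕ d)))

  profile⇒Transfers : ∀ u v t →
    (∀ {x y} → x ≢ y → x ≡ v → profile u (amp h t) x y ≈ 1#) →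
    (∀ {x y} → x ≢ y → x ≢ v → profile u (amp h t) x y ≈ 0#) →
    Transfers u v t
  profile⇒Transfers u v t on off = walk⇒Transfers u v t λ a →
    trans (walk≈onArcs u t a) (by-cases a (tail a Fin.≟ v))
    where
    by-cases : ∀ a → Dec (tail a ≡ v) → onArcs u (amp h t) a ≈ N a v
    by-cases a (yes ta≡v) = trans (*-congˡ (on (tail≢head a) ta≡v)) 
      (trans (*-identityʳ s) (sym (N-source {a} ta≡v)))
    by-cases a (no ta≢v)  = trans (*-congˡ (off (tail≢head a) ta≢v)) 
      (trans (zeroʳ s) (sym (N-other {a} ta≢v)))

  -- For two vertices no arc is away from u, and then the last hypothesis is
  -- vacuous.
  return : ∀ u t → out (amp h t) ≈ 1# → into (amp h t) ≈ 0# →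
    (∀ {v w} → v ≢ u → w ≢ u → v ≢ w → away (amp h t) ≈ 0#) → Transfers u u t
  return u t out≈1 into≈0 away≈0 = profile⇒Transfers u u t
    (λ { {x} {y} x≢y ≡.refl → trans (profile-out u (amp h t) y) out≈1 })
    (λ {x} {y} x≢y x≢u → off x≢y x≢u (y Fin.≟ u))
    where
    off : ∀ {x y} → x ≢ y → x ≢ u → Dec (y ≡ u) → profile u (amp h t) x y ≈ 0#
    off x≢y x≢u (yes ≡.refl) = trans (profile-into (amp h t) x≢u) into≈0
    off x≢y x≢u (no y≢u)     = trans (profile-away (amp h t) x≢u y≢u) (away≈0 x≢u y≢u x≢y)

-- The complete graph with two vertices
module K₂ {c ℓ₁ ℓ₂} (ℝ : RealNumbers c ℓ₁ ℓ₂) (2≤2 : 2 ℕ.≤ 2) where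
  open RealNumbers ℝ
  open RealProperties ℝ
  open CompleteWalk ℝ 1 2≤2
  open Spectrum ℝ 1 2≤2
  open Transfer ℝ 1 2≤2
  open ArcReversalWalk ℝ K
  open Amplitudes ℝ 1

  onlyTwo : ∀ {x y z : Fin 2} → x ≢ y → x ≢ z → y ≡ z
  onlyTwo {zero}     {zero}     x≢y x≢z = ⊥-elim (x≢y ≡.refl)
  onlyTwo {zero}     {suc zero} {zero}     x≢y x≢z = ⊥-elim (x≢z ≡.refl)
  onlyTwo {zero}     {suc zero} {suc zero} x≢y x≢z = ≡.refl
  onlyTwo {suc zero} {zero}     {zero}     x≢y x≢z = ≡.refl
  onlyTwo {suc zero} {zero}     {suc zero} x≢y x≢z = ⊥-elim (x≢z ≡.refl)
  onlyTwo {suc zero} {suc zero} x≢y x≢z = ⊥-elim (x≢y ≡.refl)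

  h≈1 : h ≈ 1#
  h≈1 = trans (solve 1 (λ h → h := h :* (con (+ 1) :+ con (+ 0))) refl h) hd≈1

  perfectStateTransfer : ∀ u v → u ≢ v → PerfectStateTransfer u v 1
  perfectStateTransfer u v u≢v = u≢v , profile⇒Transfers u v 1
    (λ { {x} {y} x≢y ≡.refl → ≡.subst (λ w → profile u (amp h 1) x w ≈ 1#)
           (onlyTwo (u≢v ∘ ≡.sym) x≢y) (profile-into (amp h 1) (u≢v ∘ ≡.sym)) })
    (λ {x} {y} x≢y x≢v → ≡.subst (λ w → profile u (amp h 1) w y ≈ 0#)
           (onlyTwo (u≢v ∘ ≡.sym) (x≢v ∘ ≡.sym)) (trans (profile-out u (amp h 1) y) out₁≈0))

  period : ∀ u → PeriodicWithPeriod 2 u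
  period u = s≤s z≤n , return u 2 out₂≈1 out₁≈0 
    (λ v≢u w≢u v≢w → ⊥-elim (v≢w (onlyTwo (v≢u ∘ ≡.sym) (w≢u ∘ ≡.sym)))) , minimal
    where
    out₂≈1 : out (amp h 2) ≈ 1#
    out₂≈1 = trans out₂≈ (trans (+-congʳ (*-congˡ h≈1))
      (solve 0 (con (+ 2) :* con (+ 1) :- con (+ 1) := con (+ 1)) refl))
    minimal : ∀ t → 1 ℕ.≤ t → Transfers u u t → 2 ℕ.≤ t
    minimal (suc zero)    _ tr = ⊥-elim (notPeriod1 u tr)
    minimal (suc (suc t)) _ _  = s≤s (s≤s z≤n)

-- The complete graph with three vertices
module K₃ {c ℓ₁ ℓ₂} (ℝ : RealNumbers c ℓ₁ ℓ₂) (2≤3 : 2 ℕ.≤ 3) where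
  open RealNumbers ℝ
  open RealProperties ℝ
  open CompleteWalk ℝ 2 2≤3
  open Spectrum ℝ 2 2≤3
  open Transfer ℝ 2 2≤3
  open ArcReversalWalk ℝ K
  open Amplitudes ℝ 2

  -- As 2h = 1, each step permutes the amplitudes cyclically.
  2h≈1 : fromℤ (+ 2) * h ≈ 1#
  2h≈1 = trans (trans (*-comm _ _) (*-congˡ (sym (fromℕ≈fromℤ 2)))) hd≈1

  out₂≈0 : out (amp h 2) ≈ 0#
  out₂≈0 = trans out₂≈ (trans (+-congʳ 2h≈1) (-‿inverseʳ 1#))

  total₂≈1 : total (amp h 2) ≈ 1#
  total₂≈1 = trans (sym (+-identityˡ _)) (trans (+-congʳ (sym out₂≈0)) (out+total≈1 hd≈1 2))

  reflected₂≈1 : fromℤ (+ 2) * (h * total (amp h 2)) ≈ 1#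
  reflected₂≈1 = trans (*-congˡ (trans (*-congˡ total₂≈1) (*-identityʳ h))) 2h≈1

  period : ∀ u → PeriodicWithPeriod 3 u
  period u = s≤s z≤n , return u 3 out₃≈1 out₂≈0 (λ _ _ _ → away₃≈0) , minimal
    where
    out₃≈1 : out (amp h 3) ≈ 1#
    out₃≈1 = trans (+-cong reflected₂≈1 (trans (-‿cong out₁≈0) -0#≈0#)) (+-identityʳ 1#)
    away₃≈0 : away (amp h 3) ≈ 0#
    away₃≈0 = trans (+-cong reflected₂≈1 (-‿cong (trans away₂≈ 2h≈1))) (-‿inverseʳ 1#)
    minimal : ∀ t → 1 ℕ.≤ t → Transfers u u t → 3 ℕ.≤ t
    minimal (suc zero)          _ tr = ⊥-elim (notPeriod1 u tr)
    minimal (suc (suc zero))    _ tr = ⊥-elim (notPeriod2 ℕ.≤-refl u tr)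
    minimal (suc (suc (suc t))) _ _  = s≤s (s≤s (s≤s z≤n))

open import Data.Nat.Base using (_≤_; _<_)

lemma4p1 : ∀ {c ℓ₁ ℓ₂} (ℝ : RealNumbers c ℓ₁ ℓ₂) →
    let open ArcReversalWalk ℝ in
    (∀ n (2≤n : 2 ≤ n) → let K = complete-graph n 2≤n in
    (2 < n → ¬ (∃[ u ] ∃[ v ] ∃[ t ] PeakStateTransfer K u v t)) ×
    (3 < n → ¬ (∃[ u ] Periodic K u))) ×
    (∀ (2≤2 : 2 ≤ 2) → let K₂ = complete-graph 2 2≤2 in
    (∀ u v → u ≢ v → PerfectStateTransfer K₂ u v 1) ×
    (∀ u → PeriodicWithPeriod K₂ 2 u)) ×
    (∀ (2≤3 : 2 ≤ 3) → let K₃ = complete-graph 3 2≤3 in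
    (∀ u → PeriodicWithPeriod K₃ 3 u))
lemma4p1 ℝ =
    (λ { (suc d) 2≤n → (λ { (s≤s 2≤d) → Spectrum.noPeakStateTransfer ℝ d 2≤n 2≤d })
                     , (λ { (s≤s 3≤d) → Transfer.notPeriodic ℝ d 2≤n 3≤d }) })
  , (λ 2≤2 → K₂.perfectStateTransfer ℝ 2≤2 , K₂.period ℝ 2≤2)
  , (λ 2≤3 → K₃.period ℝ 2≤3)
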